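{- If the set of colors $C$ has a group structure, then for every $n$ the homogeneous component $\mathbf{Sym}^{(l)}_n$ of degree $n$ becomes a subalgebra of the group algebra $\mathbb C[C\wr\mathfrak S_n]$ under the identification $\mathbf G_h\mapsto h$, for $h=(\sigma,u)\in\mathfrak S_n\times C^n$; that is, the image of $\mathbf{Sym}_n^{(l)}$ under this linear map is a subalgebra of $\mathbb C[C\wr\mathfrak S_n]$.
   Context: Here $\mathbb N=\{0,1,2,\dots\}$. Let $l\ge1$ and let $C=\{c_0,\dots,c_{l-1}\}$ be a set of $l$ colors. A colored permutation of size $n\ge0$ is a pair $(\sigma,u)$ with $\sigma\in\mathfrak S_n$, $u\in C^n$ (permutations are written as words; color words are indexed by positions). Let $\mathbf{FQSym}^{(l)}$ be the graded algebra over $\mathbb C$ with basis $(\mathbf G_{\sigma,u})$ indexed by all colored permutations (degree = size), with product $$\mathbf G_{\sigma',u'}\mathbf G_{\sigma'',u''}=\sum_{\sigma\in\sigma'*\sigma''}\mathbf G_{\sigma,u'\cdot u''},$$ where $u'\cdot u''$ is concatenation and $\sigma'*\sigma''$ is the set of permutations $\tau$ of size $|\sigma'|+|\sigma''|$ whose first $|\sigma'|$ letters standardize to $\sigma'$ and whose remaining letters standardize to $\sigma''$ (the standardization of a word with distinct integer letters is the permutation whose letters are in the same relative order). For $\mathbf n=(n_0,\dots,n_{l-1})\in\mathbb N^l$ with $|\mathbf n|=\sum_i n_i=n$, put $S_{\mathbf n}=\sum_{u}\mathbf G_{12\cdots n,u}$, the sum over all $u\in C^n$ having exactly $n_i$ occurrences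 of the color $c_i$ for each $i$ (and $S_{\mathbf 0}=1$). $\mathbf{Sym}^{(l)}$ is the subalgebra of $\mathbf{FQSym}^{(l)}$ generated by the $S_{\mathbf n}$, and $\mathbf{Sym}^{(l)}_n$ is its degree $n$ component. When $C$ is a group, the wreath product $C\wr\mathfrak S_n=\mathfrak S_n\ltimes C^n$ is the set of colored permutations of size $n$ with multiplication $$(\sigma;c_1,\dots,c_n)\cdot(\tau;d_1,\dots,d_n)=(\sigma\tau;\,c_{\tau(1)}d_1,\dots,c_{\tau(n)}d_n),$$ where here $c_i,d_i$ denote elements of $C$ and $(\sigma\tau)(i)=\sigma(\tau(i))$. -}

module Defs where

open import Algebra.Bundles using (CommutativeRing; Group)
open import Algebra.Core using (Op₁; Op₂)
open import Algebra.Structures using (IsGroup)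
open import Data.Fin.Base as Fin using (Fin; zero; _↑ˡ_; _↑ʳ_)
open import Data.Fin.Permutation as Perm
  using (Permutation′; _⟨$⟩ʳ_; _⟨$⟩ˡ_; _∘ₚ_; insert; inverseˡ; inverseʳ)
import Data.Fin.Properties as Fin
open import Data.List.Base as List using (List; []; _∷_; [_]; concatMap; allFin)
open import Data.Nat.Base using (ℕ; zero; suc)
import Data.Nat.Base as ℕ
import Data.Nat.Properties as ℕ
open import Data.Product.Base using (∃; _×_; _,_; map₁)
open import Data.Product.Relation.Binary.Pointwise.NonDependent using (×-decSetoid)
open import Data.Vec.Base as Vec using (Vec; []; _∷_; lookup; tabulate; count; sum)
open import Data.Vec.Properties
  using (lookup∘tabulate; lookup-replicate; tabulate-cong; tabulate∘lookup; ≡-dec)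
open import Function.Bundles using (_⇔_; Equivalence; mk⇔)
open import Level using (Level; 0ℓ; _⊔_) renaming (suc to lsuc)
open import Relation.Binary.Bundles using (DecSetoid)
open import Relation.Binary.Core using (Rel)
open import Relation.Binary.Definitions using (Decidable)
open import Relation.Binary.PropositionalEquality as ≡
  using (_≡_; refl; sym; trans; cong)
open import Relation.Nullary.Decidable as Dec
  using (Dec; yes; no; does; _×-dec_; _→-dec_)
open import Relation.Unary using (Pred)
open import Data.Bool.Base using (if_then_else_)

private
  variable
    a c ℓ m ℓm p : Level

record RawAlgebra (K : Set c) m ℓm : Set (c ⊔ lsuc (m ⊔ ℓm)) where
  infixl 7 _*_
  infixr 7 _*ₗ_
  infixl 6 _+_
  infix  4 _≈_
  field
    Carrier : Set m
    _≈_     : Rel Carrier ℓm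
    0#      : Carrier
    _+_     : Op₂ Carrier
    _*ₗ_    : K → Carrier → Carrier
    1#      : Carrier
    _*_     : Op₂ Carrier

module _ {K : Set c} (A : RawAlgebra K m ℓm) where
  open RawAlgebra A

  record IsSubalgebra (P : Pred Carrier p) : Set (c ⊔ m ⊔ ℓm ⊔ p) where
    field
      ≈-closed  : ∀ {x y} → x ≈ y → P x → P y
      0#-closed : P 0#
      +-closed  : ∀ {x y} → P x → P y → P (x + y)
      *ₗ-closed : ∀ k {x} → P x → P (k *ₗ x)
      1#-closed : P 1#
      *-closed  : ∀ {x y} → P x → P y → P (x * y)

  data Generated {I : Set a} (g : I → Carrier) : Pred Carrier (c ⊔ m ⊔ ℓm ⊔ a) where
    generator : ∀ i → Generated g (g i)
    respects  : ∀ {x y} → x ≈ y → Generated g x → Generated g y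
    zeroᵍ     : Generated g 0#
    addᵍ      : ∀ {x y} → Generated g x → Generated g y → Generated g (x + y)
    scaleᵍ    : ∀ k {x} → Generated g x → Generated g (k *ₗ x)
    oneᵍ      : Generated g 1#
    mulᵍ      : ∀ {x y} → Generated g x → Generated g y → Generated g (x * y)

  Image : ∀ {X : Set a} → (X → Carrier) → Pred X p → Pred Carrier (a ⊔ ℓm ⊔ p)
  Image f P y = ∃ λ x → P x × f x ≈ y

ColoredPermutation : ℕ → ℕ → Set
ColoredPermutation l n = Permutation′ n × Vec (Fin l) n

permutationDecSetoid : ℕ → DecSetoid 0ℓ 0ℓ
permutationDecSetoid n = record
  { Carrier = Permutation′ n
  ; _≈_ = Perm._≈_
  ; isDecEquivalence = record
    { isEquivalence = record
      { refl  = λ _ → refl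
      ; sym   = λ eq i → sym (eq i)
      ; trans = λ eq eq′ i → trans (eq i) (eq′ i)
      }
    ; _≟_ = λ σ τ → Fin.all? λ i → (σ ⟨$⟩ʳ i) Fin.≟ (τ ⟨$⟩ʳ i)
    }
  }

coloredDecSetoid : ℕ → ℕ → DecSetoid 0ℓ 0ℓ
coloredDecSetoid l n =
  ×-decSetoid (permutationDecSetoid n) (≡.decSetoid (≡-dec {n = n} (Fin._≟_ {l})))

module _ (l : ℕ) where
  private
    module CP {n} = DecSetoid (coloredDecSetoid l n)

  infix 4 _≈ₛ_
  data _≈ₛ_ : Rel (∃ (ColoredPermutation l)) 0ℓ where
    sameSize : ∀ {n} {g h : ColoredPermutation l n} → g CP.≈ h → (n , g) ≈ₛ (n , h)

  _≟ₛ_ : Decidable _≈ₛ_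
  (i , g) ≟ₛ (j , h) with i ℕ.≟ j
  ... | no  i≢j  = no λ { (sameSize _) → i≢j refl }
  ... | yes refl = Dec.map′ sameSize (λ { (sameSize g≈h) → g≈h }) (g CP.≟ h)

  allSizesDecSetoid : DecSetoid 0ℓ 0ℓ
  allSizesDecSetoid = record
    { Carrier = ∃ (ColoredPermutation l)
    ; _≈_ = _≈ₛ_
    ; isDecEquivalence = record
      { isEquivalence = record
        { refl  = λ { {n , g} → sameSize (CP.refl {n} {g}) }
        ; sym   = λ { {n , g} {_ , h} (sameSize e) →
                    sameSize (CP.sym {n} {g} {h} e) }
        ; trans = λ { {n , g} {_ , h} {_ , k} (sameSize e) (sameSize e′) →
                    sameSize (CP.trans {n} {g} {h} {k} e e′) }
        }
      ; _≟_ = _≟ₛ_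
      }
    }

-- Each permutation occurs exactly once, up to pointwise equality.
allPermutations : ∀ n → List (Permutation′ n)
allPermutations zero    = [ Perm.id ]
allPermutations (suc n) =
  List.cartesianProductWith (insert zero) (allFin (suc n)) (allPermutations n)

allWords : ∀ l n → List (Vec (Fin l) n)
allWords l zero    = [ [] ]
allWords l (suc n) = List.cartesianProductWith _∷_ (allFin l) (allWords l n)

-- A permutation σ is read as the word σ(1)⋯σ(n), here with letters and
-- positions counted from 0.

StandardizesTo : ∀ {k n} → (Fin k → Fin n) → Permutation′ k → Set
StandardizesTo w σ = ∀ i j → (w i Fin.< w j) ⇔ (σ ⟨$⟩ʳ i Fin.< σ ⟨$⟩ʳ j)

standardizesTo? : ∀ {k n} (w : Fin k → Fin n) σ → Dec (StandardizesTo w σ)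
standardizesTo? w σ = Fin.all? λ i → Fin.all? λ j →
  let A? = w i Fin.<? w j
      B? = (σ ⟨$⟩ʳ i) Fin.<? (σ ⟨$⟩ʳ j)
  in Dec.map′ (λ (to , from) → mk⇔ to from)
              (λ e → Equivalence.to e , Equivalence.from e)
              ((A? →-dec B?) ×-dec (B? →-dec A?))

-- The set σ′ * σ″ of the product rule.
convolution : ∀ {i j} → Permutation′ i → Permutation′ j → List (Permutation′ (i ℕ.+ j))
convolution {i} {j} σ′ σ″ = List.filter
  (λ τ → standardizesTo? (λ x → τ ⟨$⟩ʳ (x ↑ˡ j)) σ′
   ×-dec standardizesTo? (λ y → τ ⟨$⟩ʳ (i ↑ʳ y)) σ″)
  (allPermutations (i ℕ.+ j))

HasContent : ∀ {l n} → Vec ℕ l → Vec (Fin l) n → Set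
HasContent 𝐧 u = ∀ i → count (i Fin.≟_) u ≡ lookup 𝐧 i

hasContent? : ∀ {l n} (𝐧 : Vec ℕ l) (u : Vec (Fin l) n) → Dec (HasContent 𝐧 u)
hasContent? 𝐧 u = Fin.all? λ i → count (i Fin.≟_) u ℕ.≟ lookup 𝐧 i

module _ {l : ℕ} {_∙_ : Op₂ (Fin l)} {ε : Fin l} {_⁻¹ : Op₁ (Fin l)}
         (C : IsGroup _≡_ _∙_ ε _⁻¹) (n : ℕ) where
  private
    module C = IsGroup C
    module CP = DecSetoid (coloredDecSetoid l n)

  -- Stdlib's _∘ₚ_ composes from left to right, so τ ∘ₚ σ is i ↦ σ(τ(i)).
  _≀∙_ : Op₂ (ColoredPermutation l n)
  (σ , c) ≀∙ (τ , d) =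
    τ ∘ₚ σ , tabulate λ i → lookup c (τ ⟨$⟩ʳ i) ∙ lookup d i

  ≀ε : ColoredPermutation l n
  ≀ε = Perm.id , Vec.replicate n ε

  _≀⁻¹ : Op₁ (ColoredPermutation l n)
  (σ , c) ≀⁻¹ = Perm.flip σ , tabulate λ i → lookup c (σ ⟨$⟩ˡ i) ⁻¹

  wreathGroup : Group 0ℓ 0ℓ
  wreathGroup = record
    { Carrier = ColoredPermutation l n
    ; _≈_ = CP._≈_
    ; _∙_ = _≀∙_
    ; ε = ≀ε
    ; _⁻¹ = _≀⁻¹
    ; isGroup = record
      { isMonoid = record
        { isSemigroup = record
          { isMagma = record
            { isEquivalence = CP.isEquivalence
            ; ∙-cong = λ { {σ , c} {_ , _} {τ , d} {τ′ , _} (σ≈ , refl) (τ≈ , refl) →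
                (λ i → trans (cong (σ ⟨$⟩ʳ_) (τ≈ i)) (σ≈ (τ′ ⟨$⟩ʳ i))) ,
                tabulate-cong (λ i → cong (λ k → lookup c k ∙ lookup d i) (τ≈ i)) }
            }
          ; assoc = λ { (σ , c) (τ , d) (ρ , e) → (λ _ → refl) , tabulate-cong λ i →
              trans (cong (_∙ lookup e i) (lookup∘tabulate _ (ρ ⟨$⟩ʳ i)))
             (trans (C.assoc _ _ _)
                    (cong (lookup c (τ ⟨$⟩ʳ (ρ ⟨$⟩ʳ i)) ∙_) (sym (lookup∘tabulate _ i)))) }
          }
        ; identity =
            (λ { (σ , c) → (λ _ → refl) , trans
              (tabulate-cong λ i →
                trans (cong (_∙ lookup c i) (lookup-replicate (σ ⟨$⟩ʳ i) ε)) (C.identityˡ _))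
              (tabulate∘lookup c) })
          , (λ { (σ , c) → (λ _ → refl) , trans
              (tabulate-cong λ i →
                trans (cong (lookup c i ∙_) (lookup-replicate i ε)) (C.identityʳ _))
              (tabulate∘lookup c) })
        }
      ; inverse =
          (λ { (σ , c) → (λ _ → inverseˡ σ) , ext λ i →
            trans (cong (_∙ lookup c i)
                        (trans (lookup∘tabulate _ (σ ⟨$⟩ʳ i))
                               (cong (λ k → lookup c k ⁻¹) (inverseˡ σ))))
                  (C.inverseˡ _) })
        , (λ { (σ , c) → (λ _ → inverseʳ σ) , ext λ i →
            trans (cong (lookup c (σ ⟨$⟩ˡ i) ∙_) (lookup∘tabulate _ i))
                  (C.inverseʳ _) })
      ; ⁻¹-cong = λ { {σ , c} {τ , _} (σ≈τ , refl) →
          let σ⁻¹≈τ⁻¹ : ∀ i → σ ⟨$⟩ˡ i ≡ τ ⟨$⟩ˡ i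
              σ⁻¹≈τ⁻¹ i = trans (sym (inverseˡ τ))
                (cong (τ ⟨$⟩ˡ_) (trans (sym (σ≈τ (σ ⟨$⟩ˡ i))) (inverseʳ σ)))
          in σ⁻¹≈τ⁻¹ , tabulate-cong λ i → cong (λ k → lookup c k ⁻¹) (σ⁻¹≈τ⁻¹ i) }
      }
    }
    where
    ext : ∀ {f : Fin n → Fin l} → (∀ i → f i ≡ ε) → tabulate f ≡ Vec.replicate n ε
    ext {f} f≡ε = trans
      (tabulate-cong λ i → trans (f≡ε i) (sym (lookup-replicate i ε)))
      (tabulate∘lookup (Vec.replicate n ε))

module _ (R : CommutativeRing c ℓ) where
  private
    module R = CommutativeRing R

  -- Elements of the free R-module on a set with decidable equality, as finite
  -- sums Σ r·b.  They are identified when all their coefficients agree, so the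
  -- order of the terms, repeated basis elements and zero terms do not matter.
  FormalSum : Set a → Set (a ⊔ c)
  FormalSum B = List (R.Carrier × B)

  basis : {B : Set a} → B → FormalSum B
  basis b = [ R.1# , b ]

  -- The sum of the listed basis elements.
  sumOf : {B : Set a} → List B → FormalSum B
  sumOf = concatMap basis

  linearExtension : {A B : Set a} → (A → FormalSum B) → FormalSum A → FormalSum B
  linearExtension f = concatMap λ (r , x) → List.map (map₁ (r R.*_)) (f x)

  bilinearExtension : {B : Set a} → (B → B → FormalSum B) → Op₂ (FormalSum B)
  bilinearExtension f x y = linearExtension (λ g → linearExtension (f g) y) x

  module _ (B : DecSetoid a p) where
    private
      module B = DecSetoid B

    coefficient : FormalSum B.Carrier → B.Carrier → R.Carrier
    coefficient []            b = R.0#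
    coefficient ((r , x) ∷ t) b =
      (if does (x B.≟ b) then r else R.0#) R.+ coefficient t b

    freeModuleAlgebra : (B.Carrier → B.Carrier → FormalSum B.Carrier) →
                        FormalSum B.Carrier → RawAlgebra R.Carrier (a ⊔ c) (a ⊔ ℓ)
    freeModuleAlgebra mul one = record
      { Carrier = FormalSum B.Carrier
      ; _≈_     = λ x y → ∀ b → coefficient x b R.≈ coefficient y b
      ; 0#      = []
      ; _+_     = List._++_
      ; _*ₗ_    = λ k → List.map (map₁ (k R.*_))
      ; 1#      = one
      ; _*_     = bilinearExtension mul
      }

  groupAlgebra : (G : Group a p) → Decidable (Group._≈_ G) →
                 RawAlgebra R.Carrier (a ⊔ c) (a ⊔ ℓ)
  groupAlgebra G _≟_ = freeModuleAlgebra
    (record { isDecEquivalence = record { isEquivalence = G.isEquivalence ; _≟_ = _≟_ } })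
    (λ g h → basis (g G.∙ h))
    (basis G.ε)
    where module G = Group G

  wreathAlgebra : ∀ {l} {_∙_ : Op₂ (Fin l)} {ε : Fin l} {_⁻¹ : Op₁ (Fin l)} →
                  IsGroup _≡_ _∙_ ε _⁻¹ → ℕ → RawAlgebra R.Carrier c ℓ
  wreathAlgebra {l} C n =
    groupAlgebra (wreathGroup C n) (DecSetoid._≟_ (coloredDecSetoid l n))

  module _ (l : ℕ) where
    𝐆 : ∀ {n} → ColoredPermutation l n → FormalSum (∃ (ColoredPermutation l))
    𝐆 {n} h = basis (n , h)

    FQSym : RawAlgebra R.Carrier c ℓ
    FQSym = freeModuleAlgebra (allSizesDecSetoid l)
      (λ (i , σ′ , u′) (j , σ″ , u″) →
        sumOf (List.map (λ τ → i ℕ.+ j , τ , u′ Vec.++ u″) (convolution σ′ σ″)))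
      (𝐆 (Perm.id {0} , []))

    S : Vec ℕ l → RawAlgebra.Carrier FQSym
    S 𝐧 = concatMap (λ u → 𝐆 (Perm.id , u))
            (List.filter (hasContent? 𝐧) (allWords l (sum 𝐧)))

    Sym : Pred (RawAlgebra.Carrier FQSym) (c ⊔ ℓ)
    Sym = Generated FQSym S

    -- The degree n component of FQSym, and its inclusion in FQSym.
    FQSymₙ : ℕ → Set c
    FQSymₙ n = FormalSum (ColoredPermutation l n)

    inclusion : ∀ n → FQSymₙ n → RawAlgebra.Carrier FQSym
    inclusion n = linearExtension 𝐆

    Symₙ : ∀ n → Pred (FQSymₙ n) (c ⊔ ℓ)
    Symₙ n x = Sym (inclusion n x)

  -- The linear map G_h ↦ h: as a set, the wreath product is the basis of FQSymₙ.
  identification : ∀ {l} {_∙_ : Op₂ (Fin l)} {ε : Fin l} {_⁻¹ : Op₁ (Fin l)}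
                   (C : IsGroup _≡_ _∙_ ε _⁻¹) n →
                   FQSymₙ l n → RawAlgebra.Carrier (wreathAlgebra C n)
  identification C n = linearExtension λ h → basis h

module Submission where

-- Let a : {1..n} → {1..k} be weakly increasing and let F be a function of color
-- words that depends only on the number of letters of each color in each block
-- of a.  Let T(a,F) be the sum of F(u) G_{σ,u} over all u and all σ that increase
-- on the blocks of a.  The T(a,F) of size n span Sym_n: the product of T(a,F) and
-- T(b,H) in FQSym is T of the juxtaposed labelling with weight F ⊗ H, and
-- conversely F can be expanded along the contents of its first block, which
-- splits off factors S_𝐧.
--
-- In the wreath product, the coefficient of T(a,F)·T(b,H) at (ρ,e) is a sum over
-- the factorizations ρ = στ with σ increasing on the blocks of a and τ on those
-- of b.  Group it by the word α = a ∘ τ.  Given ρ and α, at most one such σ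
-- exists, and τ increases on the blocks of b if and only if x ↦ (b x, α x) is
-- weakly increasing and ρ increases on its blocks.  The remaining sum over color
-- words depends on τ only through α, so each α contributes one T or nothing.

open import Defs
open import Algebra.Bundles using (CommutativeRing; Group)
open import Algebra.Core using (Op₁; Op₂)
import Algebra.Properties.Group as GroupProperties
open import Algebra.Structures using (IsGroup)
open import Data.Bool.Base using (true; false; if_then_else_)
open import Data.Fin.Base as Fin using (Fin; zero; suc; _↑ˡ_; _↑ʳ_; punchIn; combine)
import Data.Fin.Induction as Fin
open import Data.Fin.Permutation as Perm
  using (Permutation′; _⟨$⟩ʳ_; _⟨$⟩ˡ_; _∘ₚ_; insert; remove; inverseˡ; inverseʳ)
import Data.Fin.Properties as Fin
open import Data.List.Base as List using (List; []; _∷_; _++_; concatMap; allFin)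
open import Data.List.Membership.Propositional using (_∈_; lose)
import Data.List.Membership.Propositional.Properties as List
import Data.List.Properties as List
import Data.List.Relation.Unary.Any as Any
open import Data.Nat.Base as ℕ using (ℕ; zero; suc; _≤_)
import Data.Nat.Properties as ℕ
open import Algebra.Properties.CommutativeMonoid.Sum ℕ.+-0-commutativeMonoid
  using (sum; sum-remove; sum-permute; sum-cong-≗; sum-replicate-zero)
  renaming (∑-distrib-+ to sum-distrib-+)
open import Data.Product.Base using (∃; ∃₂; Σ; _×_; _,_; proj₁; proj₂; map₁)
open import Data.Product.Properties using (≡-dec)
open import Data.Sum.Base as Sum using (_⊎_; inj₁; inj₂)
open import Data.Vec.Base as Vec using (Vec; []; _∷_; lookup; tabulate)
import Data.Vec.Properties as Vec
open import Function.Base using (_∘_; id)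
open import Function.Bundles using (_⇔_; Equivalence; mk⇔)
open import Induction.WellFounded as WF using ()
open import Level using (Level; 0ℓ)
open import Relation.Binary.Bundles using (DecSetoid)
open import Relation.Binary.Definitions using (DecidableEquality; tri<; tri≈; tri>)
open import Relation.Binary.PropositionalEquality as ≡ using (_≡_; _≢_; _≗_)
open import Relation.Nullary using (¬_; Dec; yes; no; does; contradiction)
open import Relation.Nullary.Decidable as Dec
  using (_×-dec_; _→-dec_; dec-true; dec-false; does-⇔; ¬?)
open import Relation.Unary as Unary using (Decidable; Pred)

-- Products of the generators `S 𝐧` alone would be an awkward spanning set for the group algebra:
-- the color words of two factors are multiplied letter by letter with the group law, and the result
-- of combining two content indicators is in general not a content indicator. Allowing an arbitrary
-- symmetric weight F absorbs these structure constants. The color sum is again some function of the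
-- color word, and all that remains to check is that it depends only on the contents of the new
-- blocks.
--
-- Hence empty blocks cost nothing, α may run over all words in the labels of a, and the pair (b x,
-- α x) can be used as a label without renumbering.

private
  variable
    c ℓ ℓa ℓb ℓp : Level
    A A′ A″ : Set ℓa
    P Q : Set ℓp
    i j k k′ l m n : ℕ

-- Increasing maps, matchings and standardization

perm-injective : (π : Permutation′ n) {x y : Fin n} → π ⟨$⟩ʳ x ≡ π ⟨$⟩ʳ y → x ≡ y
perm-injective π eq = ≡.trans (≡.sym (inverseˡ π)) (≡.trans (≡.cong (π ⟨$⟩ˡ_) eq) (inverseˡ π))

Monotone : (Fin n → Fin k) → Set
Monotone a = ∀ x y → x Fin.≤ y → a x Fin.≤ a y

IncreasingOnBlocks : (Fin n → Fin k) → (Fin n → Fin m) → Set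
IncreasingOnBlocks a w = ∀ x y → x Fin.< y → a x ≡ a y → w x Fin.< w y

increasingOnBlocks? : (a : Fin n → Fin k) (w : Fin n → Fin m) → Dec (IncreasingOnBlocks a w)
increasingOnBlocks? a w = Fin.all? λ x → Fin.all? λ y →
  (x Fin.<? y) →-dec ((a x Fin.≟ a y) →-dec (w x Fin.<? w y))

increasing-cong : {a b : Fin n → Fin k} {v w : Fin n → Fin m} →
                  a ≗ b → v ≗ w → IncreasingOnBlocks a v → IncreasingOnBlocks b w
increasing-cong a≗b v≗w inc x y x<y bx≡by =
  ≡.subst₂ Fin._<_ (v≗w x) (v≗w y)
    (inc x y x<y (≡.trans (a≗b x) (≡.trans bx≡by (≡.sym (a≗b y)))))

first : {P : Fin n → Set ℓ} → Decidable P → ∃ P → ∃ λ x → P x × (∀ y → P y → x Fin.≤ y)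
first {n = suc n} P? (x , px) with P? zero
... | yes p0 = zero , p0 , λ _ _ → ℕ.z≤n
first {n = suc n} P? (zero , px) | no ¬p0 = contradiction px ¬p0
first {n = suc n} P? (suc x , px) | no ¬p0 =
  let y , py , least = first (P? ∘ suc) (x , px)
  in suc y , py , λ { zero p0 → contradiction p0 ¬p0 ; (suc z) pz → ℕ.s≤s (least z pz) }

-- Kept general in `X` because two kinds of words are matched later: words of block labels, to find
-- the factors of a permutation, and words of pairs (block, color), to compare color words block by
-- block.
module Occurrences {X : Set} (_≟_ : DecidableEquality X) where
  occurrences : (Fin n → X) → X → ℕ
  occurrences f x = sum λ i → if does (x ≟ f i) then 1 else 0

  occurrences-cong : {f g : Fin n → X} → f ≗ g → ∀ x → occurrences f x ≡ occurrences g x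
  occurrences-cong f≗g x = sum-cong-≗ λ i → ≡.cong (λ y → if does (x ≟ y) then 1 else 0) (f≗g i)

  occurrences-permute : (f : Fin n → X) (π : Permutation′ n) →
                        ∀ x → occurrences (f ∘ (π ⟨$⟩ʳ_)) x ≡ occurrences f x
  occurrences-permute f π x = ≡.sym (sum-permute (λ i → if does (x ≟ f i) then 1 else 0) π)

  occurrences-≢ : (f : Fin n → X) (x : X) → (∀ i → x ≢ f i) → occurrences f x ≡ 0
  occurrences-≢ {n} f x x∉f = ≡.trans
    (sum-cong-≗ λ i → ≡.cong (if_then 1 else 0) (dec-false (x ≟ f i) (x∉f i)))
    (sum-replicate-zero n)

  occurrences-++ : ∀ i {j} (f : Fin (i ℕ.+ j) → X) x →
                   occurrences f x ≡ occurrences (f ∘ (_↑ˡ j)) x ℕ.+ occurrences (f ∘ (i ↑ʳ_)) x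
  occurrences-++ zero f x = ≡.refl
  occurrences-++ (suc i) f x = ≡.trans
    (≡.cong (here ℕ.+_) (occurrences-++ i (f ∘ suc) x)) (≡.sym (ℕ.+-assoc here _ _))
    where
    here : ℕ
    here = if does (x ≟ f zero) then 1 else 0

  -- The position of f 0 in g is the first possible one, which makes π increasing
  -- on the fibres of f.
  matching : (f g : Fin n → X) → (∀ x → occurrences f x ≡ occurrences g x) →
             ∃ λ (π : Permutation′ n) → (∀ x → g (π ⟨$⟩ʳ x) ≡ f x) ×
               (∀ x y → x Fin.< y → f x ≡ f y → π ⟨$⟩ʳ x Fin.< π ⟨$⟩ʳ y)
  matching {zero}  f g eq = Perm.id , (λ ()) , λ ()
  matching {suc n} f g eq with Fin.any? (λ y → f zero ≟ g y)
  ... | no ∄y = contradiction (≡.trans (≡.sym f0-occurs) f0-absent) ℕ.1+n≢0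
    where
    f0-absent : occurrences f (f zero) ≡ 0
    f0-absent = ≡.trans (eq (f zero)) (occurrences-≢ g _ λ y f0≡gy → ∄y (y , f0≡gy))
    f0-occurs : occurrences f (f zero) ≡ suc (occurrences (f ∘ suc) (f zero))
    f0-occurs = ≡.cong (λ b → (if b then 1 else 0) ℕ.+ occurrences (f ∘ suc) (f zero))
                     (dec-true (f zero ≟ f zero) ≡.refl)
  ... | yes ∃y with first (λ y → f zero ≟ g y) ∃y
  ...   | p , f0≡gp , least = insert zero p π , commutes , increasing
    where
    rest-eq : ∀ x → occurrences (f ∘ suc) x ≡ occurrences (g ∘ punchIn p) x
    rest-eq x = ℕ.+-cancelˡ-≡ (if does (x ≟ f zero) then 1 else 0) _ _ (≡.trans (eq x)
      (≡.trans (sum-remove {i = p} (λ i → if does (x ≟ g i) then 1 else 0))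
             (≡.cong (λ z → (if does (x ≟ z) then 1 else 0) ℕ.+ occurrences (g ∘ punchIn p) x)
                   (≡.sym f0≡gp))))
    ih = matching (f ∘ suc) (g ∘ punchIn p) rest-eq
    π = proj₁ ih
    commutes : ∀ x → g (insert zero p π ⟨$⟩ʳ x) ≡ f x
    commutes zero    = ≡.sym f0≡gp
    commutes (suc x) = proj₁ (proj₂ ih) x
    increasing : ∀ x y → x Fin.< y → f x ≡ f y →
                 insert zero p π ⟨$⟩ʳ x Fin.< insert zero p π ⟨$⟩ʳ y
    increasing zero (suc y) _ f0≡fy = Fin.≤∧≢⇒<
      (least _ (≡.trans f0≡fy (≡.sym (commutes (suc y)))))
      (λ p≡ → Fin.punchInᵢ≢i p _ (≡.sym p≡))
    increasing (suc x) (suc y) (ℕ.s≤s x<y) fx≡fy =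
      punchIn-mono-< p (proj₂ (proj₂ ih) x y x<y fx≡fy)
      where
      punchIn-mono-< : ∀ {m} (p : Fin (suc m)) {x y} → x Fin.< y → punchIn p x Fin.< punchIn p y
      punchIn-mono-< p x<y = ℕ.≰⇒> λ le → ℕ.<⇒≱ x<y (Fin.punchIn-cancel-≤ p _ _ le)

-- Suppose σ x < τ x, and let z be the position of the letter σ x in τ. It lies in the block of x,
-- since the letters have the same blocks under σ and τ. If z < x, then σ and τ agree at z and σ
-- repeats a letter; z = x contradicts strictness; if z > x, then τ fails to increase on that block.
blockIncreasing-≤ : (a : Fin n → Fin k) (σ τ : Permutation′ n) →
  (∀ x → a (σ ⟨$⟩ˡ x) ≡ a (τ ⟨$⟩ˡ x)) →
  IncreasingOnBlocks a (τ ⟨$⟩ʳ_) →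
  ∀ x → (∀ y → y Fin.< x → σ ⟨$⟩ʳ y ≡ τ ⟨$⟩ʳ y) → ¬ (σ ⟨$⟩ʳ x Fin.< τ ⟨$⟩ʳ x)
blockIncreasing-≤ a σ τ aσ≗aτ incτ x smaller σx<τx with Fin.<-cmp (τ ⟨$⟩ˡ (σ ⟨$⟩ʳ x)) x
... | tri< z<x _ _ = contradiction
  (perm-injective σ (≡.trans (smaller _ z<x) (inverseʳ τ))) (Fin.<⇒≢ z<x)
... | tri≈ _ z≡x _ = contradiction (≡.trans (≡.sym (inverseʳ τ)) (≡.cong (τ ⟨$⟩ʳ_) z≡x)) (Fin.<⇒≢ σx<τx)
... | tri> _ _ x<z = ℕ.<-asym σx<τx (≡.subst (τ ⟨$⟩ʳ x Fin.<_) (inverseʳ τ)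
  (incτ x _ x<z (≡.trans (≡.cong a (≡.sym (inverseˡ σ))) (aσ≗aτ _))))

-- The first hypothesis says that σ and τ send each block onto the same set of letters, and a set of
-- letters can be listed increasingly in one way only. The induction is on positions, with
-- `blockIncreasing-≤` applied in both directions.
blockIncreasing-unique : (a : Fin n → Fin k) (σ τ : Permutation′ n) →
  (∀ x → a (σ ⟨$⟩ˡ x) ≡ a (τ ⟨$⟩ˡ x)) →
  IncreasingOnBlocks a (σ ⟨$⟩ʳ_) → IncreasingOnBlocks a (τ ⟨$⟩ʳ_) → σ Perm.≈ τ
blockIncreasing-unique a σ τ aσ≗aτ incσ incτ = <-rec _ λ x smaller → agree x smaller
  where
  open WF.All Fin.<-wellFounded _ renaming (wfRec to <-rec)
  agree : ∀ x → (∀ {y} → y Fin.< x → σ ⟨$⟩ʳ y ≡ τ ⟨$⟩ʳ y) → σ ⟨$⟩ʳ x ≡ τ ⟨$⟩ʳ x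
  agree x smaller with Fin.<-cmp (σ ⟨$⟩ʳ x) (τ ⟨$⟩ʳ x)
  ... | tri≈ _ eq _ = eq
  ... | tri< lt _ _ = contradiction lt
    (blockIncreasing-≤ a σ τ aσ≗aτ incτ x λ _ → smaller)
  ... | tri> _ _ gt = contradiction gt
    (blockIncreasing-≤ a τ σ (≡.sym ∘ aσ≗aτ) incσ x λ _ → ≡.sym ∘ smaller)

-- As a labelling this is a single block, so `IncreasingOnBlocks allZero` means increasing
-- everywhere. The generators `S 𝐧` are block sums for it.
allZero : Fin n → Fin 1
allZero _ = zero

-- Both permutations order the positions as `w` does, so τσ⁻¹ is increasing on the single block of
-- all positions, hence the identity.
standardization-unique : {w : Fin k → Fin n} (σ τ : Permutation′ k) →
  StandardizesTo w σ → StandardizesTo w τ → σ Perm.≈ τ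
standardization-unique {k} {w = w} σ τ stdσ stdτ x =
  ≡.trans (≡.sym (τσ⁻¹≈id (σ ⟨$⟩ʳ x))) (≡.cong (τ ⟨$⟩ʳ_) (inverseˡ σ))
  where
  τσ⁻¹≈id : (Perm.flip σ ∘ₚ τ) Perm.≈ Perm.id
  τσ⁻¹≈id = blockIncreasing-unique allZero (Perm.flip σ ∘ₚ τ) Perm.id (λ _ → ≡.refl)
    (λ y z y<z _ → Equivalence.to (stdτ _ _) (Equivalence.from (stdσ _ _)
      (≡.subst₂ Fin._<_ (≡.sym (inverseʳ σ)) (≡.sym (inverseʳ σ)) y<z)))
    (λ _ _ y<z _ → y<z)

argmin : (w : Fin (suc k) → Fin n) → ∃ λ x → ∀ y → w x Fin.≤ w y
argmin {zero}  w = zero , λ { zero → ℕ.≤-refl }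
argmin {suc k} w with argmin (w ∘ suc)
... | x , min with ℕ.≤-total (Fin.toℕ (w zero)) (Fin.toℕ (w (suc x)))
...   | inj₁ w0≤wx = zero , λ { zero → ℕ.≤-refl ; (suc y) → ℕ.≤-trans w0≤wx (min y) }
...   | inj₂ wx≤w0 = suc x , λ { zero → wx≤w0 ; (suc y) → min y }

data PunchView (p : Fin (suc n)) : Fin (suc n) → Set where
  here  : PunchView p p
  other : ∀ x → PunchView p (punchIn p x)

punchView : (p x : Fin (suc n)) → PunchView p x
punchView p x with p Fin.≟ x
... | yes ≡.refl = here
... | no  p≢x  = ≡.subst (PunchView p) (Fin.punchIn-punchOut p≢x) (other _)

-- Induction on the length: the position of the smallest letter receives 0, and the standardization
-- of the other letters is shifted up by one.
standardize : (w : Fin k → Fin n) → (∀ {x y} → w x ≡ w y → x ≡ y) → ∃ (StandardizesTo w)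
standardize {zero}  w w-inj = Perm.id , λ ()
standardize {suc k} w w-inj with argmin w
... | p , min = σ , λ x y → compare (punchView p x) (punchView p y)
  where
  ih = standardize (w ∘ punchIn p) (λ eq → Fin.punchIn-injective p _ _ (w-inj eq))
  σ = insert p zero (proj₁ ih)
  σp≡0 : σ ⟨$⟩ʳ p ≡ zero
  σp≡0 with p Fin.≟ p
  ... | yes _  = ≡.refl
  ... | no p≢p = contradiction ≡.refl p≢p
  σ-other : ∀ x → σ ⟨$⟩ʳ punchIn p x ≡ suc (proj₁ ih ⟨$⟩ʳ x)
  σ-other = Perm.insert-punchIn p zero (proj₁ ih)
  compare : ∀ {x y} → PunchView p x → PunchView p y →
            (w x Fin.< w y) ⇔ (σ ⟨$⟩ʳ x Fin.< σ ⟨$⟩ʳ y)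
  compare here here = mk⇔ (λ lt → contradiction lt (ℕ.<-irrefl ≡.refl))
                          (λ lt → contradiction lt (ℕ.<-irrefl ≡.refl))
  compare here (other y) = mk⇔
    (λ _ → ≡.subst₂ Fin._<_ (≡.sym σp≡0) (≡.sym (σ-other y)) ℕ.z<s)
    (λ _ → Fin.≤∧≢⇒< (min _) λ eq → Fin.punchInᵢ≢i p y (≡.sym (w-inj eq)))
  compare (other x) here = mk⇔
    (λ lt → contradiction lt (ℕ.≤⇒≯ (min _)))
    (λ lt → contradiction (≡.subst (σ ⟨$⟩ʳ punchIn p x Fin.<_) σp≡0 lt) λ ())
  compare (other x) (other y) = mk⇔
    (λ lt → ≡.subst₂ Fin._<_ (≡.sym (σ-other x)) (≡.sym (σ-other y))
      (ℕ.s<s (Equivalence.to (proj₂ ih x y) lt)))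
    (λ lt → Equivalence.from (proj₂ ih x y)
      (ℕ.s<s⁻¹ (≡.subst₂ Fin._<_ (σ-other x) (σ-other y) lt)))

standardizesTo-cong : (v w : Fin k → Fin n) (σ τ : Permutation′ k) →
                      v ≗ w → σ Perm.≈ τ → StandardizesTo v σ → StandardizesTo w τ
standardizesTo-cong v w σ τ v≗w σ≈τ std x y = mk⇔
  (λ lt → ≡.subst₂ Fin._<_ (σ≈τ x) (σ≈τ y)
    (Equivalence.to (std x y) (≡.subst₂ Fin._<_ (≡.sym (v≗w x)) (≡.sym (v≗w y)) lt)))
  (λ lt → ≡.subst₂ Fin._<_ (v≗w x) (v≗w y)
    (Equivalence.from (std x y) (≡.subst₂ Fin._<_ (≡.sym (σ≈τ x)) (≡.sym (σ≈τ y)) lt)))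

-- The blocks of b come after those of a.
infixr 5 _⊔ˡ_
_⊔ˡ_ : (Fin i → Fin k) → (Fin j → Fin k′) → Fin (i ℕ.+ j) → Fin (k ℕ.+ k′)
_⊔ˡ_ {i} {k} {j} {k′} a b x = Fin.join k k′ (Sum.map a b (Fin.splitAt i x))

⊔ˡ-↑ˡ : (a : Fin i → Fin k) (b : Fin j → Fin k′) → ∀ x → (a ⊔ˡ b) (x ↑ˡ j) ≡ a x ↑ˡ k′
⊔ˡ-↑ˡ {i} {k} {j} {k′} a b x = ≡.cong (Fin.join k k′ ∘ Sum.map a b) (Fin.splitAt-↑ˡ i x j)

⊔ˡ-↑ʳ : (a : Fin i → Fin k) (b : Fin j → Fin k′) → ∀ x → (a ⊔ˡ b) (i ↑ʳ x) ≡ k ↑ʳ b x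
⊔ˡ-↑ʳ {i} {k} {j} {k′} a b x = ≡.cong (Fin.join k k′ ∘ Sum.map a b) (Fin.splitAt-↑ʳ i j x)

↑ˡ≢↑ʳ : (x : Fin i) (y : Fin j) → x ↑ˡ j ≢ i ↑ʳ y
↑ˡ≢↑ʳ {i} {j} x y eq with ≡.trans (≡.sym (Fin.splitAt-↑ˡ i x j))
                           (≡.trans (≡.cong (Fin.splitAt i) eq) (Fin.splitAt-↑ʳ i j y))
... | ()

↑ˡ<↑ʳ : (x : Fin i) (y : Fin j) → x ↑ˡ j Fin.< i ↑ʳ y
↑ˡ<↑ʳ zero    y = ℕ.z<s
↑ˡ<↑ʳ (suc x) y = ℕ.s<s (↑ˡ<↑ʳ x y)

data SplitView i {j} : Fin (i ℕ.+ j) → Set where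
  left  : ∀ x → SplitView i (x ↑ˡ j)
  right : ∀ y → SplitView i (i ↑ʳ y)

splitView : ∀ i {j} (x : Fin (i ℕ.+ j)) → SplitView i x
splitView i {j} x = ≡.subst (SplitView i) (Fin.join-splitAt i j x) (view (Fin.splitAt i x))
  where
  view : (s : Fin i ⊎ Fin j) → SplitView i (Fin.join i j s)
  view (inj₁ y) = left y
  view (inj₂ y) = right y

↑ˡ-mono-≤ : ∀ j {x y : Fin i} → x Fin.≤ y → x ↑ˡ j Fin.≤ y ↑ˡ j
↑ˡ-mono-≤ j {x} {y} = ≡.subst₂ ℕ._≤_ (≡.sym (Fin.toℕ-↑ˡ x j)) (≡.sym (Fin.toℕ-↑ˡ y j))

↑ˡ-cancel-≤ : ∀ j {x y : Fin i} → x ↑ˡ j Fin.≤ y ↑ˡ j → x Fin.≤ y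
↑ˡ-cancel-≤ j {x} {y} = ≡.subst₂ ℕ._≤_ (Fin.toℕ-↑ˡ x j) (Fin.toℕ-↑ˡ y j)

↑ʳ-mono-≤ : ∀ i {x y : Fin j} → x Fin.≤ y → i ↑ʳ x Fin.≤ i ↑ʳ y
↑ʳ-mono-≤ zero    le = le
↑ʳ-mono-≤ (suc i) le = ℕ.s≤s (↑ʳ-mono-≤ i le)

↑ʳ-cancel-≤ : ∀ i {x y : Fin j} → i ↑ʳ x Fin.≤ i ↑ʳ y → x Fin.≤ y
↑ʳ-cancel-≤ zero    le = le
↑ʳ-cancel-≤ (suc i) le = ↑ʳ-cancel-≤ i (ℕ.s≤s⁻¹ le)

⊔ˡ-monotone : {a : Fin i → Fin k} {b : Fin j → Fin k′} →
              Monotone a → Monotone b → Monotone (a ⊔ˡ b)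
⊔ˡ-monotone {i} {k} {j} {k′} {a} {b} mono-a mono-b x y = compare (splitView i x) (splitView i y)
  where
  compare : ∀ {x y} → SplitView i x → SplitView i y → x Fin.≤ y → (a ⊔ˡ b) x Fin.≤ (a ⊔ˡ b) y
  compare (left x) (left y) le = ≡.subst₂ Fin._≤_ (≡.sym (⊔ˡ-↑ˡ a b x)) (≡.sym (⊔ˡ-↑ˡ a b y))
    (↑ˡ-mono-≤ k′ (mono-a x y (↑ˡ-cancel-≤ j le)))
  compare (left x) (right y) le = ≡.subst₂ Fin._≤_ (≡.sym (⊔ˡ-↑ˡ a b x)) (≡.sym (⊔ˡ-↑ʳ a b y))
    (ℕ.<⇒≤ (↑ˡ<↑ʳ (a x) (b y)))
  compare (right x) (left y) le = contradiction le (ℕ.<⇒≱ (↑ˡ<↑ʳ y x))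
  compare (right x) (right y) le = ≡.subst₂ Fin._≤_ (≡.sym (⊔ˡ-↑ʳ a b x)) (≡.sym (⊔ˡ-↑ʳ a b y))
    (↑ʳ-mono-≤ k (mono-b x y (↑ʳ-cancel-≤ i le)))

↑ˡ-mono-< : ∀ j {x y : Fin i} → x Fin.< y → x ↑ˡ j Fin.< y ↑ˡ j
↑ˡ-mono-< j {x} {y} = ≡.subst₂ ℕ._<_ (≡.sym (Fin.toℕ-↑ˡ x j)) (≡.sym (Fin.toℕ-↑ˡ y j))

↑ˡ-cancel-< : ∀ j {x y : Fin i} → x ↑ˡ j Fin.< y ↑ˡ j → x Fin.< y
↑ˡ-cancel-< j {x} {y} = ≡.subst₂ ℕ._<_ (Fin.toℕ-↑ˡ x j) (Fin.toℕ-↑ˡ y j)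

↑ʳ-mono-< : ∀ i {x y : Fin j} → x Fin.< y → i ↑ʳ x Fin.< i ↑ʳ y
↑ʳ-mono-< zero    lt = lt
↑ʳ-mono-< (suc i) lt = ℕ.s≤s (↑ʳ-mono-< i lt)

↑ʳ-cancel-< : ∀ i {x y : Fin j} → i ↑ʳ x Fin.< i ↑ʳ y → x Fin.< y
↑ʳ-cancel-< zero    lt = lt
↑ʳ-cancel-< (suc i) lt = ↑ʳ-cancel-< i (ℕ.s≤s⁻¹ lt)

-- No block of `a ⊔ˡ b` meets both halves, and standardizing a half preserves all comparisons within
-- it.
increasing-⊔ˡ : {a : Fin i → Fin k} {b : Fin j → Fin k′} {w : Fin (i ℕ.+ j) → Fin m}
  {σ : Permutation′ i} {τ : Permutation′ j} →
  StandardizesTo (w ∘ (_↑ˡ j)) σ → StandardizesTo (w ∘ (i ↑ʳ_)) τ →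
  IncreasingOnBlocks (a ⊔ˡ b) w ⇔
  (IncreasingOnBlocks a (σ ⟨$⟩ʳ_) × IncreasingOnBlocks b (τ ⟨$⟩ʳ_))
increasing-⊔ˡ {i} {k} {j} {k′} {a = a} {b} {w} {σ} {τ} stdσ stdτ = mk⇔
  (λ inc →
    (λ x y x<y ax≡ay → Equivalence.to (stdσ x y) (inc _ _ (↑ˡ-mono-< j x<y)
      (≡.trans (⊔ˡ-↑ˡ a b x) (≡.trans (≡.cong (_↑ˡ k′) ax≡ay) (≡.sym (⊔ˡ-↑ˡ a b y)))))) ,
    (λ x y x<y bx≡by → Equivalence.to (stdτ x y) (inc _ _ (↑ʳ-mono-< i x<y)
      (≡.trans (⊔ˡ-↑ʳ a b x) (≡.trans (≡.cong (k ↑ʳ_) bx≡by) (≡.sym (⊔ˡ-↑ʳ a b y)))))))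
  (λ (incσ , incτ) x y → increasing incσ incτ (splitView i x) (splitView i y))
  where
  increasing : IncreasingOnBlocks a (σ ⟨$⟩ʳ_) → IncreasingOnBlocks b (τ ⟨$⟩ʳ_) →
    ∀ {x y} → SplitView i x → SplitView i y →
    x Fin.< y → (a ⊔ˡ b) x ≡ (a ⊔ˡ b) y → w x Fin.< w y
  increasing incσ incτ (left x) (left y) x<y eq = Equivalence.from (stdσ x y)
    (incσ x y (↑ˡ-cancel-< j x<y) (Fin.↑ˡ-injective k′ _ _
      (≡.trans (≡.sym (⊔ˡ-↑ˡ a b x)) (≡.trans eq (⊔ˡ-↑ˡ a b y)))))
  increasing incσ incτ (left x) (right y) x<y eq = contradiction
    (≡.trans (≡.sym (⊔ˡ-↑ˡ a b x)) (≡.trans eq (⊔ˡ-↑ʳ a b y))) (↑ˡ≢↑ʳ _ _)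
  increasing incσ incτ (right x) (left y) x<y eq = contradiction x<y (ℕ.<-asym (↑ˡ<↑ʳ y x))
  increasing incσ incτ (right x) (right y) x<y eq = Equivalence.from (stdτ x y)
    (incτ x y (↑ʳ-cancel-< i x<y) (Fin.↑ʳ-injective k _ _
      (≡.trans (≡.sym (⊔ˡ-↑ʳ a b x)) (≡.trans eq (⊔ˡ-↑ʳ a b y)))))

-- The inductive step of `splitZeroBlock`: one more position in the first block changes no label of
-- the others, because all positions of that block are labelled `zero`.
shift : (b : Fin j → Fin k) (s : Fin i ⊎ Fin j) →
  Fin.join 1 k (Sum.map allZero b s) ≡ Fin.join 1 k (Sum.map allZero b (Sum.map suc id s))
shift b (inj₁ _) = ≡.refl
shift b (inj₂ _) = ≡.refl

-- A weakly increasing labelling takes the value `zero` on an initial segment, possibly empty.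
-- Splitting it off lowers the number of labels by one, which is what the induction in `block-sym`
-- runs on.
splitZeroBlock : (a : Fin n → Fin (suc k)) → Monotone a →
  ∃₂ λ i j → Σ (i ℕ.+ j ≡ n) λ eq → Σ (Fin j → Fin k) λ b →
  Monotone b × (∀ x → a (≡.subst Fin eq x) ≡ (allZero {i} ⊔ˡ b) x)
splitZeroBlock {zero}  a mono = 0 , 0 , ≡.refl , (λ ()) , (λ ()) , λ ()
splitZeroBlock {suc n} a mono with a zero in a0
... | zero with splitZeroBlock (a ∘ suc) (λ x y x≤y → mono (suc x) (suc y) (ℕ.s≤s x≤y))
...   | i , j , ≡.refl , b , mono-b , a≗ = suc i , j , ≡.refl , b , mono-b , λ
  { zero → a0 ; (suc x) → ≡.trans (a≗ x) (shift b (Fin.splitAt i x)) }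
-- The first label is positive, so by monotonicity `zero` never occurs: the first block is empty and
-- every label drops by one.
splitZeroBlock {suc n} {k} a mono | suc y = 0 , suc n , ≡.refl , b , b-mono , λ x → ≡.sym (suc-b x)
  where
  a≢0 : ∀ x → zero ≢ a x
  a≢0 x 0≡ax = contradiction (≡.subst₂ Fin._≤_ a0 (≡.sym 0≡ax) (mono zero x ℕ.z≤n)) λ ()
  b : Fin (suc n) → Fin k
  b x = Fin.punchOut (a≢0 x)
  suc-b : ∀ x → suc (b x) ≡ a x
  suc-b x = Fin.punchIn-punchOut (a≢0 x)
  b-mono : Monotone b
  b-mono x y x≤y = ℕ.s≤s⁻¹ (≡.subst₂ Fin._≤_ (≡.sym (suc-b x)) (≡.sym (suc-b y)) (mono x y x≤y))

-- `combine` orders pairs lexicographically. A labelling by pairs thus becomes an ordinary labelling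
-- by one finite ordinal, and weakly increasing keeps its meaning.
combine-monoʳ-≤ : (x : Fin m) {y z : Fin n} → y Fin.≤ z → combine x y Fin.≤ combine x z
combine-monoʳ-≤ {m} {n} x {y} {z} y≤z = ≡.subst₂ ℕ._≤_
  (≡.sym (Fin.toℕ-combine x y)) (≡.sym (Fin.toℕ-combine x z)) (ℕ.+-monoʳ-≤ (n ℕ.* Fin.toℕ x) y≤z)

combine-cancelʳ-≤ : (x : Fin m) {y z : Fin n} → combine x y Fin.≤ combine x z → y Fin.≤ z
combine-cancelʳ-≤ {m} {n} x {y} {z} le = ℕ.+-cancelˡ-≤ (n ℕ.* Fin.toℕ x) _ _
  (≡.subst₂ ℕ._≤_ (Fin.toℕ-combine x y) (Fin.toℕ-combine x z) le)

monotone? : (a : Fin n → Fin k) → Dec (Monotone a)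
monotone? a = Fin.all? λ x → Fin.all? λ y → (x Fin.≤? y) →-dec (a x Fin.≤? a y)

-- For x < y in one block of b, the inequality τ x < τ y holds if the block of a
-- containing τ x comes before that of τ y, and amounts to σ (τ x) < σ (τ y) if
-- the two blocks coincide.
factor-increasing : (a : Fin n → Fin k) (b : Fin n → Fin k′) (σ τ : Permutation′ n) →
  Monotone a → Monotone b → IncreasingOnBlocks a (σ ⟨$⟩ʳ_) →
  let p = λ x → combine (b x) (a (τ ⟨$⟩ʳ x)) in
  IncreasingOnBlocks b (τ ⟨$⟩ʳ_) ⇔
  (Monotone p × IncreasingOnBlocks p (λ x → σ ⟨$⟩ʳ (τ ⟨$⟩ʳ x)))
factor-increasing {n} {k} {k′} a b σ τ mono-a mono-b incσ = mk⇔
  (λ incτ → refined-monotone incτ , λ x y x<y px≡py →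
    let bx≡by , aτx≡aτy = Fin.combine-injective (b x) _ (b y) _ px≡py
    in incσ _ _ (incτ x y x<y bx≡by) aτx≡aτy)
  (λ (mono-p , incρ) x y x<y bx≡by → increasing mono-p incρ x y x<y bx≡by)
  where
  p : Fin n → Fin (k′ ℕ.* k)
  p x = combine (b x) (a (τ ⟨$⟩ʳ x))
  refined-monotone : IncreasingOnBlocks b (τ ⟨$⟩ʳ_) → Monotone p
  refined-monotone incτ x y x≤y with Fin.<-cmp x y
  ... | tri≈ _ ≡.refl _ = ℕ.≤-refl
  ... | tri> _ _ y<x = contradiction x≤y (ℕ.<⇒≱ y<x)
  ... | tri< x<y _ _ with b x Fin.≟ b y
  ...   | yes bx≡by = ≡.subst (λ z → p x Fin.≤ combine z (a (τ ⟨$⟩ʳ y))) bx≡by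
    (combine-monoʳ-≤ (b x) (mono-a _ _ (ℕ.<⇒≤ (incτ x y x<y bx≡by))))
  ...   | no bx≢by = ℕ.<⇒≤ (Fin.combine-monoˡ-< _ _ (Fin.≤∧≢⇒< (mono-b x y x≤y) bx≢by))
  increasing : Monotone p → IncreasingOnBlocks p (λ x → σ ⟨$⟩ʳ (τ ⟨$⟩ʳ x)) →
               IncreasingOnBlocks b (τ ⟨$⟩ʳ_)
  increasing mono-p incρ x y x<y bx≡by with Fin.<-cmp (τ ⟨$⟩ʳ x) (τ ⟨$⟩ʳ y)
  ... | tri< lt _ _ = lt
  ... | tri≈ _ eq _ = contradiction (perm-injective τ eq) (Fin.<⇒≢ x<y)
  ... | tri> _ _ gt = contradiction
    (incσ _ _ gt (≡.sym aτx≡aτy))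
    (ℕ.<-asym (incρ x y x<y (≡.cong₂ combine bx≡by aτx≡aτy)))
    where
    -- Monotonicity of `p` inside one block of `b` gives ≤; the assumption τ y < τ x and
    -- monotonicity of `a` give ≥. Then ρ = στ and σ order the two letters in opposite ways.
    aτx≡aτy : a (τ ⟨$⟩ʳ x) ≡ a (τ ⟨$⟩ʳ y)
    aτx≡aτy = Fin.≤-antisym
      (combine-cancelʳ-≤ (b y) (≡.subst (λ z → combine z (a (τ ⟨$⟩ʳ x)) Fin.≤ p y) bx≡by
        (mono-p x y (ℕ.<⇒≤ x<y))))
      (mono-a _ _ (ℕ.<⇒≤ gt))

-- Contents of color words relative to a labelling

module Letters {l : ℕ} = Occurrences (Fin._≟_ {l})
module Pairs {k l : ℕ} = Occurrences (≡-dec (Fin._≟_ {k}) (Fin._≟_ {l}))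
open Pairs using () renaming (occurrences to pairOccurrences)

infixr 4 _▹_
_▹_ : (Fin n → Fin k) → Vec (Fin l) n → Fin n → Fin k × Fin l
(a ▹ u) x = a x , lookup u x

SameContent : (Fin n → Fin k) → (u v : Vec (Fin l) n) → Set
SameContent a u v = ∀ z → pairOccurrences (a ▹ u) z ≡ pairOccurrences (a ▹ v) z

rearranged : (Fin m → Fin n) → Vec (Fin l) n → Vec (Fin l) m
rearranged w u = tabulate (λ x → lookup u (w x))

sameContent-rearranged : (a : Fin n → Fin k) (π : Permutation′ n) →
  (∀ x → a (π ⟨$⟩ʳ x) ≡ a x) → (u : Vec (Fin l) n) → SameContent a (rearranged (π ⟨$⟩ʳ_) u) u
sameContent-rearranged a π aπ≗a u z = ≡.trans
  (Pairs.occurrences-cong (λ x → ≡.cong₂ _,_ (≡.sym (aπ≗a x)) (Vec.lookup∘tabulate _ x)) z)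
  (Pairs.occurrences-permute (a ▹ u) π z)

-- `matching` for the two words of pairs: agreement of the first components keeps π inside the
-- blocks, agreement of the second carries `v` to `u`. Symmetry of a weight thereby becomes
-- invariance under the permutations that preserve the blocks.
sameContent⇒rearranged : (a : Fin n → Fin k) {u v : Vec (Fin l) n} → SameContent a u v →
  ∃ λ (π : Permutation′ n) → (∀ x → a (π ⟨$⟩ʳ x) ≡ a x) × u ≡ rearranged (π ⟨$⟩ʳ_) v
sameContent⇒rearranged a {u} {v} same =
  let π , eq , _ = Pairs.matching (a ▹ u) (a ▹ v) same
  in π , (λ x → ≡.cong proj₁ (eq x)) ,
     ≡.trans (≡.sym (Vec.tabulate∘lookup u)) (Vec.tabulate-cong λ x → ≡.sym (≡.cong proj₂ (eq x)))

module _ (a : Fin i → Fin k) (b : Fin j → Fin k′) (u : Vec (Fin l) i) (v : Vec (Fin l) j) where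

  private
    atˡ : ∀ x → ((a ⊔ˡ b) ▹ (u Vec.++ v)) (x ↑ˡ j) ≡ (a x ↑ˡ k′ , lookup u x)
    atˡ x = ≡.cong₂ _,_ (⊔ˡ-↑ˡ a b x) (Vec.lookup-++ˡ u v x)
    atʳ : ∀ x → ((a ⊔ˡ b) ▹ (u Vec.++ v)) (i ↑ʳ x) ≡ (k ↑ʳ b x , lookup v x)
    atʳ x = ≡.cong₂ _,_ (⊔ˡ-↑ʳ a b x) (Vec.lookup-++ʳ u v x)

  content-⊔ˡ : ∀ z → pairOccurrences ((a ⊔ˡ b) ▹ (u Vec.++ v)) z ≡
    pairOccurrences (λ x → a x ↑ˡ k′ , lookup u x) z ℕ.+
    pairOccurrences (λ x → k ↑ʳ b x , lookup v x) z
  content-⊔ˡ z = ≡.trans (Pairs.occurrences-++ i ((a ⊔ˡ b) ▹ (u Vec.++ v)) z)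
    (≡.cong₂ ℕ._+_ (Pairs.occurrences-cong atˡ z) (Pairs.occurrences-cong atʳ z))

  content-left : ∀ x c →
    pairOccurrences ((a ⊔ˡ b) ▹ (u Vec.++ v)) (x ↑ˡ k′ , c) ≡ pairOccurrences (a ▹ u) (x , c)
  content-left x c = ≡.trans (content-⊔ˡ (x ↑ˡ k′ , c)) (≡.trans
    (≡.cong₂ ℕ._+_
      (sum-cong-≗ λ y → ≡.cong (if_then 1 else 0) (does-⇔
        (mk⇔ (λ eq → ≡.cong₂ _,_ (Fin.↑ˡ-injective k′ _ _ (≡.cong proj₁ eq)) (≡.cong proj₂ eq))
             (λ eq → ≡.cong₂ _,_ (≡.cong (_↑ˡ k′) (≡.cong proj₁ eq)) (≡.cong proj₂ eq)))
        (≡-dec Fin._≟_ Fin._≟_ (x ↑ˡ k′ , c) (a y ↑ˡ k′ , lookup u y))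
        (≡-dec Fin._≟_ Fin._≟_ (x , c) (a y , lookup u y))))
      (Pairs.occurrences-≢ _ _ λ y eq → ↑ˡ≢↑ʳ x (b y) (≡.cong proj₁ eq)))
    (ℕ.+-identityʳ _))

  content-right : ∀ x c →
    pairOccurrences ((a ⊔ˡ b) ▹ (u Vec.++ v)) (k ↑ʳ x , c) ≡ pairOccurrences (b ▹ v) (x , c)
  content-right x c = ≡.trans (content-⊔ˡ (k ↑ʳ x , c))
    (≡.cong₂ ℕ._+_
      (Pairs.occurrences-≢ (λ y → a y ↑ˡ k′ , lookup u y) _
        λ y eq → ↑ˡ≢↑ʳ (a y) x (≡.sym (≡.cong proj₁ eq)))
      (sum-cong-≗ λ y → ≡.cong (if_then 1 else 0) (does-⇔
        (mk⇔ (λ eq → ≡.cong₂ _,_ (Fin.↑ʳ-injective k _ _ (≡.cong proj₁ eq)) (≡.cong proj₂ eq))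
             (λ eq → ≡.cong₂ _,_ (≡.cong (k ↑ʳ_) (≡.cong proj₁ eq)) (≡.cong proj₂ eq)))
        (≡-dec Fin._≟_ Fin._≟_ (k ↑ʳ x , c) (k ↑ʳ b y , lookup v y))
        (≡-dec Fin._≟_ Fin._≟_ (x , c) (b y , lookup v y)))))

module _ (a : Fin i → Fin k) (b : Fin j → Fin k′)
         {u u′ : Vec (Fin l) i} {v v′ : Vec (Fin l) j} where

  -- Each label of `a ⊔ˡ b` comes from one half only, so every pair (label, color) is counted in
  -- that half alone.
  sameContent-⊔ˡ : SameContent (a ⊔ˡ b) (u Vec.++ v) (u′ Vec.++ v′) ⇔
                   (SameContent a u u′ × SameContent b v v′)
  sameContent-⊔ˡ = mk⇔
    (λ same →
      (λ (x , c) → ≡.trans (≡.sym (content-left a b u v x c))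
                         (≡.trans (same (x ↑ˡ k′ , c)) (content-left a b u′ v′ x c))) ,
      (λ (x , c) → ≡.trans (≡.sym (content-right a b u v x c))
                         (≡.trans (same (k ↑ʳ x , c)) (content-right a b u′ v′ x c))))
    (λ (sameˡ , sameʳ) (x , c) → join sameˡ sameʳ (splitView k x) c)
    where
    join : SameContent a u u′ → SameContent b v v′ → ∀ {x} → SplitView k x → ∀ c →
      pairOccurrences ((a ⊔ˡ b) ▹ (u Vec.++ v)) (x , c) ≡
      pairOccurrences ((a ⊔ˡ b) ▹ (u′ Vec.++ v′)) (x , c)
    join sameˡ sameʳ (left x) c = ≡.trans (content-left a b u v x c)
      (≡.trans (sameˡ (x , c)) (≡.sym (content-left a b u′ v′ x c)))
    join sameˡ sameʳ (right x) c = ≡.trans (content-right a b u v x c)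
      (≡.trans (sameʳ (x , c)) (≡.sym (content-right a b u′ v′ x c)))

count-∷ : ∀ (c d : Fin l) (u : Vec (Fin l) n) →
  Vec.count (c Fin.≟_) (d ∷ u) ≡ (if does (c Fin.≟ d) then 1 else 0) ℕ.+ Vec.count (c Fin.≟_) u
count-∷ c d u with does (c Fin.≟ d)
... | true  = ≡.refl
... | false = ≡.refl

-- The bridge from `HasContent`, which defines the generators, to content relative to the one-block
-- labelling.
count≡pairOccurrences : (u : Vec (Fin l) n) (c : Fin l) →
                        Vec.count (c Fin.≟_) u ≡ pairOccurrences (allZero ▹ u) (zero , c)
count≡pairOccurrences []      c = ≡.refl
count≡pairOccurrences (d ∷ u) c = ≡.trans (count-∷ c d u) (≡.cong₂ ℕ._+_
  (≡.cong (if_then 1 else 0) (does-⇔ (mk⇔ (≡.cong (zero ,_)) (≡.cong proj₂))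
    (c Fin.≟ d) (≡-dec (Fin._≟_ {1}) Fin._≟_ (zero , c) (zero , d))))
  (count≡pairOccurrences u c))

hasContent-sameContent : {𝐧 : Vec ℕ l} {u v : Vec (Fin l) n} →
  SameContent allZero u v → HasContent 𝐧 u → HasContent 𝐧 v
hasContent-sameContent {u = u} {v} same content c = ≡.trans
  (≡.trans (count≡pairOccurrences v c) (≡.trans (≡.sym (same (zero , c))) (≡.sym (count≡pairOccurrences u c))))
  (content c)

sameContent-hasContent : {𝐧 : Vec ℕ l} {u v : Vec (Fin l) n} →
  HasContent 𝐧 u → HasContent 𝐧 v → SameContent allZero u v
sameContent-hasContent {u = u} {v} contentᵘ contentᵛ (zero , c) =
  ≡.trans (≡.sym (count≡pairOccurrences u c))
    (≡.trans (≡.trans (contentᵘ c) (≡.sym (contentᵛ c))) (count≡pairOccurrences v c))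

sum-lookup : (𝐧 : Vec ℕ l) → Vec.sum 𝐧 ≡ sum (lookup 𝐧)
sum-lookup []       = ≡.refl
sum-lookup (m ∷ 𝐧) = ≡.cong (m ℕ.+_) (sum-lookup 𝐧)

sum-indicator : (d : Fin l) → sum (λ c → if does (c Fin.≟ d) then 1 else 0) ≡ 1
sum-indicator {suc l} zero    = ≡.cong suc (sum-replicate-zero l)
sum-indicator {suc l} (suc d) = sum-indicator d

sum-counts : (u : Vec (Fin l) n) → sum (λ c → Vec.count (c Fin.≟_) u) ≡ n
sum-counts {l} []  = sum-replicate-zero l
sum-counts (d ∷ u) = ≡.trans (sum-cong-≗ λ c → count-∷ c d u)
  (≡.trans (sum-distrib-+ (λ c → if does (c Fin.≟ d) then 1 else 0) (λ c → Vec.count (c Fin.≟_) u))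
         (≡.cong₂ ℕ._+_ (sum-indicator d) (sum-counts u)))

-- Used in contrapositive form: a content of the wrong total is carried by no word, so its term in
-- the expansion of a block sum vanishes.
hasContent-sum : {𝐧 : Vec ℕ l} (u : Vec (Fin l) n) → HasContent 𝐧 u → Vec.sum 𝐧 ≡ n
hasContent-sum {𝐧 = 𝐧} u content = ≡.trans (sum-lookup 𝐧)
  (≡.trans (sum-cong-≗ (≡.sym ∘ content)) (sum-counts u))

-- Contents live in the infinite type `Vec ℕ l`. A word of length n has each color at most n times,
-- so its content is itself a word over `Fin (suc n)`, and sums over contents become sums over
-- `allWords`.
bound : Vec (Fin l) n → Fin l → Fin (suc n)
bound u c = Fin.fromℕ< (ℕ.s≤s (Vec.count≤n (c Fin.≟_) u))

boundedContent : Vec (Fin l) n → Vec (Fin (suc n)) l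
boundedContent u = tabulate (bound u)

hasContent⇔bounded : (K : Vec (Fin (suc n)) l) (u : Vec (Fin l) n) →
                     HasContent (Vec.map Fin.toℕ K) u ⇔ (K ≡ boundedContent u)
hasContent⇔bounded {n} K u = mk⇔
  (λ content → ≡.trans (≡.sym (Vec.tabulate∘lookup K)) (Vec.tabulate-cong λ c → Fin.toℕ-injective
    (≡.trans (≡.sym (Vec.lookup-map c Fin.toℕ K)) (≡.trans (≡.sym (content c)) (≡.sym (Fin.toℕ-fromℕ< _))))))
  λ eq c → ≡.sym (≡.trans (Vec.lookup-map c Fin.toℕ K)
    (≡.trans (≡.cong (λ K′ → Fin.toℕ (lookup K′ c)) eq)
      (≡.trans (≡.cong Fin.toℕ (Vec.lookup∘tabulate (bound u) c)) (Fin.toℕ-fromℕ< _))))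

∈-allWords : (u : Vec (Fin l) n) → u ∈ allWords l n
∈-allWords []      = Any.here ≡.refl
∈-allWords (c ∷ u) = List.∈-cartesianProductWith⁺ _∷_ (List.∈-allFin c) (∈-allWords u)

-- Chooses a representative word for each content that occurs; the search is finite because all
-- words of length n are listed.
someWord? : ∀ n (𝐧 : Vec ℕ l) → Dec (∃ λ (u : Vec (Fin l) n) → HasContent 𝐧 u)
someWord? n 𝐧 = Dec.map′ Any.satisfied (λ (u , content) → lose (∈-allWords u) content)
  (Any.any? (hasContent? 𝐧) (allWords _ n))

-- Formal sums

module Sums (R : CommutativeRing c ℓ) where
  open CommutativeRing R renaming (Carrier to K) hiding (zero)
  open import Algebra.Properties.Ring ring using (-1*x≈-x)
  open import Algebra.Properties.CommutativeSemigroup +-commutativeSemigroup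
    using () renaming (interchange to +-interchange; x∙yz≈y∙xz to +-swap)
  open import Relation.Binary.Reasoning.Setoid setoid

  ∑ : List A → (A → K) → K
  ∑ []       f = 0#
  ∑ (x ∷ xs) f = f x + ∑ xs f

  ∑-cong : (xs : List A) {f g : A → K} → (∀ x → f x ≈ g x) → ∑ xs f ≈ ∑ xs g
  ∑-cong []       f≈g = refl
  ∑-cong (x ∷ xs) f≈g = +-cong (f≈g x) (∑-cong xs f≈g)

  ∑-zero : (xs : List A) {f : A → K} → (∀ x → f x ≈ 0#) → ∑ xs f ≈ 0#
  ∑-zero []       f≈0 = refl
  ∑-zero (x ∷ xs) f≈0 = trans (+-cong (f≈0 x) (∑-zero xs f≈0)) (+-identityˡ 0#)

  ∑-++ : (xs ys : List A) (f : A → K) → ∑ (xs ++ ys) f ≈ ∑ xs f + ∑ ys f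
  ∑-++ []       ys f = sym (+-identityˡ _)
  ∑-++ (x ∷ xs) ys f = trans (+-congˡ (∑-++ xs ys f)) (sym (+-assoc _ _ _))

  ∑-map : (g : A → A′) (xs : List A) (f : A′ → K) → ∑ (List.map g xs) f ≈ ∑ xs (f ∘ g)
  ∑-map g []       f = refl
  ∑-map g (x ∷ xs) f = +-congˡ (∑-map g xs f)

  ∑-concatMap : (f : A → List A′) (xs : List A) (g : A′ → K) →
                ∑ (concatMap f xs) g ≈ ∑ xs (λ x → ∑ (f x) g)
  ∑-concatMap f []       g = refl
  ∑-concatMap f (x ∷ xs) g = trans (∑-++ (f x) _ g) (+-congˡ (∑-concatMap f xs g))

  ∑-cartesianProductWith : (g : A → A′ → A″) (xs : List A) (ys : List A′) (f : A″ → K) →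
    ∑ (List.cartesianProductWith g xs ys) f ≈ ∑ xs (λ x → ∑ ys (λ y → f (g x y)))
  ∑-cartesianProductWith g []       ys f = refl
  ∑-cartesianProductWith g (x ∷ xs) ys f = trans (∑-++ (List.map (g x) ys) _ f)
    (+-cong (∑-map (g x) ys f) (∑-cartesianProductWith g xs ys f))

  ∑-distribˡ : (r : K) (xs : List A) (f : A → K) → ∑ xs (λ x → r * f x) ≈ r * ∑ xs f
  ∑-distribˡ r []       f = sym (zeroʳ r)
  ∑-distribˡ r (x ∷ xs) f = trans (+-congˡ (∑-distribˡ r xs f)) (sym (distribˡ r _ _))

  ∑-distrib-+ : (xs : List A) (f g : A → K) → ∑ xs (λ x → f x + g x) ≈ ∑ xs f + ∑ xs g
  ∑-distrib-+ []       f g = sym (+-identityˡ 0#)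
  ∑-distrib-+ (x ∷ xs) f g = trans (+-congˡ (∑-distrib-+ xs f g)) (+-interchange _ _ _ _)

  ∑-comm : (xs : List A) (ys : List A′) (f : A → A′ → K) →
           ∑ xs (λ x → ∑ ys (f x)) ≈ ∑ ys (λ y → ∑ xs (λ x → f x y))
  ∑-comm []       ys f = sym (∑-zero ys λ _ → refl)
  ∑-comm (x ∷ xs) ys f = trans (+-congˡ (∑-comm xs ys f)) (sym (∑-distrib-+ ys (f x) _))

  ⟦_⟧ : Dec P → K
  ⟦ d ⟧ = if does d then 1# else 0#

  indicator-yes : (d : Dec P) → P → ⟦ d ⟧ ≈ 1#
  indicator-yes (yes _) _ = refl
  indicator-yes (no ¬p) p = contradiction p ¬p

  indicator-no : (d : Dec P) → ¬ P → ⟦ d ⟧ ≈ 0#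
  indicator-no (yes p) ¬p = contradiction p ¬p
  indicator-no (no _)  _  = refl

  indicator-⇔ : P ⇔ Q → (d : Dec P) (e : Dec Q) → ⟦ d ⟧ ≈ ⟦ e ⟧
  indicator-⇔ P⇔Q d e = reflexive (≡.cong (if_then 1# else 0#) (does-⇔ P⇔Q d e))

  indicator-× : (d : Dec P) (e : Dec Q) → ⟦ d ×-dec e ⟧ ≈ ⟦ d ⟧ * ⟦ e ⟧
  indicator-× d e with does d
  ... | true  = sym (*-identityˡ _)
  ... | false = sym (zeroˡ _)

  if-indicator : (d : Dec P) (r : K) → (if does d then r else 0#) ≈ ⟦ d ⟧ * r
  if-indicator d r with does d
  ... | true  = sym (*-identityˡ r)
  ... | false = sym (zeroˡ r)

  indicator-*-no : (d : Dec P) {x : K} → ¬ P → ⟦ d ⟧ * x ≈ 0#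
  indicator-*-no d ¬p = trans (*-congʳ (indicator-no d ¬p)) (zeroˡ _)

  indicator-*-yes : (d : Dec P) {x : K} → P → ⟦ d ⟧ * x ≈ x
  indicator-*-yes d p = trans (*-congʳ (indicator-yes d p)) (*-identityˡ _)

  ∑-filter : {P : Pred A ℓp} (P? : Unary.Decidable P) (xs : List A) (f : A → K) →
             ∑ (List.filter P? xs) f ≈ ∑ xs (λ x → ⟦ P? x ⟧ * f x)
  ∑-filter P? []       f = refl
  ∑-filter P? (x ∷ xs) f with P? x
  ... | yes _ = +-cong (sym (*-identityˡ _)) (∑-filter P? xs f)
  ... | no  _ = trans (∑-filter P? xs f) (trans (sym (+-identityˡ _)) (+-congʳ (sym (zeroˡ _))))

  -- Multiplicity one up to `≈`, stated as an identity in `K`. In positive characteristic this is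
  -- weaker than a single occurrence in the list, but it is exactly what collapsing a sum requires.
  Enumerates : (B : DecSetoid ℓa ℓb) → List (DecSetoid.Carrier B) → Set _
  Enumerates B xs = ∀ y → ∑ xs (λ x → ⟦ DecSetoid._≟_ B x y ⟧) ≈ 1#

  module _ (B : DecSetoid ℓa ℓb) where
    private module B = DecSetoid B

    -- The summand is `v` times the indicator of the class of `y`.
    ∑-single : (xs : List B.Carrier) → Enumerates B xs → {f : B.Carrier → K} (y : B.Carrier) {v : K} →
      (∀ x → x B.≈ y → f x ≈ v) → (∀ x → ¬ x B.≈ y → f x ≈ 0#) → ∑ xs f ≈ v
    ∑-single xs enum {f} y {v} f≈v f≈0 = begin
      ∑ xs f                         ≈⟨ ∑-cong xs pointwise ⟩
      ∑ xs (λ x → v * ⟦ x B.≟ y ⟧)   ≈⟨ ∑-distribˡ v xs _ ⟩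
      v * ∑ xs (λ x → ⟦ x B.≟ y ⟧)   ≈⟨ *-congˡ (enum y) ⟩
      v * 1#                         ≈⟨ *-identityʳ v ⟩
      v ∎
      where
      pointwise : ∀ x → f x ≈ v * ⟦ x B.≟ y ⟧
      pointwise x with x B.≟ y
      ... | yes x≈y = trans (f≈v x x≈y) (sym (*-identityʳ v))
      ... | no  x≉y = trans (f≈0 x x≉y) (sym (zeroʳ v))

    -- Both sides equal the double sum of `⟦ x ≟ to y ⟧ * f x`, which collapses over x to the left
    -- side and, by `adjoint`, over y to the right side.
    ∑-reindex : (xs : List B.Carrier) → Enumerates B xs →
      (to from : B.Carrier → B.Carrier) → (∀ {x y} → (x B.≈ to y) ⇔ (y B.≈ from x)) →
      {f : B.Carrier → K} → (∀ {x y} → x B.≈ y → f x ≈ f y) → ∑ xs (f ∘ to) ≈ ∑ xs f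
    ∑-reindex xs enum to from adjoint {f} f-cong = begin
      ∑ xs (λ y → f (to y))
        ≈⟨ ∑-cong xs (λ y → sym (∑-single xs enum (to y)
             (λ x x≈ → trans (*-congʳ (indicator-yes (x B.≟ to y) x≈)) (trans (*-identityˡ _) (f-cong x≈)))
             (λ x x≉ → indicator-*-no (x B.≟ to y) x≉))) ⟩
      ∑ xs (λ y → ∑ xs (λ x → ⟦ x B.≟ to y ⟧ * f x))
        ≈⟨ ∑-comm xs xs _ ⟩
      ∑ xs (λ x → ∑ xs (λ y → ⟦ x B.≟ to y ⟧ * f x))
        ≈⟨ ∑-cong xs (λ x → ∑-single xs enum (from x)
             (λ y y≈ → indicator-*-yes (x B.≟ to y) (Equivalence.from adjoint y≈))
             (λ y y≉ → indicator-*-no (x B.≟ to y) (y≉ ∘ Equivalence.to adjoint))) ⟩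
      ∑ xs f ∎

  -- Enumerations of words, permutations and colored permutations

  wordDecSetoid : ℕ → ℕ → DecSetoid 0ℓ 0ℓ
  wordDecSetoid l n = ≡.decSetoid (Vec.≡-dec {n = n} (Fin._≟_ {l}))

  ∑-allFin-suc : (f : Fin (suc n) → K) → ∑ (allFin (suc n)) f ≈ f zero + ∑ (allFin n) (f ∘ suc)
  ∑-allFin-suc {n} f = +-congˡ (trans
    (reflexive (≡.cong (λ xs → ∑ xs f) (≡.sym (List.map-tabulate id suc))))
    (∑-map suc (allFin n) f))

  enumerates-allFin : ∀ n → Enumerates (≡.decSetoid (Fin._≟_ {n})) (allFin n)
  enumerates-allFin (suc n) zero = trans
    (∑-allFin-suc {n} λ x → ⟦ x Fin.≟ zero ⟧)
    (trans (+-congˡ (∑-zero (allFin n) λ _ → refl)) (+-identityʳ 1#))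
  enumerates-allFin (suc n) (suc y) = trans
    (∑-allFin-suc {n} λ x → ⟦ x Fin.≟ suc y ⟧)
    (trans (+-identityˡ _) (enumerates-allFin n y))

  enumerates-allWords : ∀ l n → Enumerates (wordDecSetoid l n) (allWords l n)
  enumerates-allWords l zero    [] = +-identityʳ 1#
  enumerates-allWords l (suc n) w@(d ∷ u) = trans
    (∑-cartesianProductWith _∷_ (allFin l) (allWords l n) λ v → ⟦ Vec.≡-dec Fin._≟_ v w ⟧)
    (∑-single (≡.decSetoid Fin._≟_) (allFin l) (enumerates-allFin l) d
      (λ { _ ≡.refl → ∑-single (wordDecSetoid l n) (allWords l n) (enumerates-allWords l n) u
        (λ { _ ≡.refl → indicator-yes (Vec.≡-dec Fin._≟_ w w) ≡.refl })
        (λ v v≢u → indicator-no (Vec.≡-dec Fin._≟_ (d ∷ v) w) (v≢u ∘ Vec.∷-injectiveʳ)) })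
      (λ e e≢d → ∑-zero (allWords l n) λ v →
        indicator-no (Vec.≡-dec Fin._≟_ (e ∷ v) w) (e≢d ∘ Vec.∷-injectiveˡ)))

  -- A permutation σ has the form `insert zero y π` only for y = σ(0) and π = `remove zero σ`.
  enumerates-allPermutations : ∀ n → Enumerates (permutationDecSetoid n) (allPermutations n)
  enumerates-allPermutations zero    σ = trans (+-identityʳ _)
    (indicator-yes (DecSetoid._≟_ (permutationDecSetoid 0) Perm.id σ) λ ())
  enumerates-allPermutations (suc n) σ = trans
    (∑-cartesianProductWith (insert zero) (allFin (suc n)) (allPermutations n) λ τ → ⟦ τ P.≟ σ ⟧)
    (∑-single (≡.decSetoid Fin._≟_) (allFin (suc n)) (enumerates-allFin (suc n)) (σ ⟨$⟩ʳ zero)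
      (λ { _ ≡.refl → ∑-single (permutationDecSetoid n) (allPermutations n)
          (enumerates-allPermutations n) (remove zero σ)
        (λ π π≈ → indicator-yes (insert zero (σ ⟨$⟩ʳ zero) π P.≟ σ) λ
          { zero    → ≡.refl
          ; (suc x) → ≡.trans (≡.cong (Fin.punchIn (σ ⟨$⟩ʳ zero)) (π≈ x))
                              (≡.sym (Perm.punchIn-permute σ zero x)) })
        (λ π π≉ → indicator-no (insert zero (σ ⟨$⟩ʳ zero) π P.≟ σ) λ eq → π≉ λ x →
          Fin.punchIn-injective (σ ⟨$⟩ʳ zero) _ _
            (≡.trans (eq (suc x)) (Perm.punchIn-permute σ zero x))) })
      (λ y y≢ → ∑-zero (allPermutations n) λ π →
        indicator-no (insert zero y π P.≟ σ) λ eq → y≢ (eq zero)))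
    where module P = DecSetoid (permutationDecSetoid (suc n))

  allColored : ∀ l n → List (ColoredPermutation l n)
  allColored l n = List.cartesianProductWith _,_ (allPermutations n) (allWords l n)

  enumerates-allColored : ∀ l n → Enumerates (coloredDecSetoid l n) (allColored l n)
  enumerates-allColored l n (σ , u) = trans
    (∑-cartesianProductWith _,_ (allPermutations n) (allWords l n) λ h → ⟦ h C.≟ (σ , u) ⟧)
    (∑-single (permutationDecSetoid n) (allPermutations n) (enumerates-allPermutations n) σ
      (λ τ τ≈σ → ∑-single (wordDecSetoid l n) (allWords l n) (enumerates-allWords l n) u
        (λ v v≡u → indicator-yes ((τ , v) C.≟ (σ , u)) (τ≈σ , v≡u))
        (λ v v≢u → indicator-no ((τ , v) C.≟ (σ , u)) (v≢u ∘ proj₂)))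
      (λ τ τ≉σ → ∑-zero (allWords l n) λ v → indicator-no ((τ , v) C.≟ (σ , u)) (τ≉σ ∘ proj₁)))
    where module C = DecSetoid (coloredDecSetoid l n)

  -- Linear functionals, coefficients and bilinear products

  evaluate : (A → K) → FormalSum R A → K
  evaluate φ x = ∑ x λ (r , g) → r * φ g

  module _ (B : DecSetoid ℓa ℓb) where
    private
      module B = DecSetoid B
      coef : FormalSum R B.Carrier → B.Carrier → K
      coef = coefficient R B

    infix 4 _≋_
    _≋_ : FormalSum R B.Carrier → FormalSum R B.Carrier → Set _
    x ≋ y = ∀ g → coef x g ≈ coef y g

    Respects : (B.Carrier → K) → Set _
    Respects φ = ∀ {g h} → g B.≈ h → φ g ≈ φ h

    coefficient-evaluate : ∀ x g → coef x g ≈ evaluate (λ h → ⟦ h B.≟ g ⟧) x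
    coefficient-evaluate []            g = refl
    coefficient-evaluate ((r , h) ∷ x) g =
      +-cong (trans (if-indicator (h B.≟ g) r) (*-comm _ _)) (coefficient-evaluate x g)

    indicator-respects : ∀ g → Respects (λ h → ⟦ h B.≟ g ⟧)
    indicator-respects g {h} {h′} h≈h′ =
      indicator-⇔ (mk⇔ (B.trans (B.sym h≈h′)) (B.trans h≈h′)) (h B.≟ g) (h′ B.≟ g)

    coefficient-++ : ∀ x y g → coef (x ++ y) g ≈ coef x g + coef y g
    coefficient-++ []      y g = sym (+-identityˡ _)
    coefficient-++ (_ ∷ x) y g = trans (+-congˡ (coefficient-++ x y g)) (sym (+-assoc _ _ _))

    evaluate-scale : ∀ φ r (x : FormalSum R B.Carrier) →
                     evaluate φ (List.map (map₁ (r *_)) x) ≈ r * evaluate φ x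
    evaluate-scale φ r []            = sym (zeroʳ r)
    evaluate-scale φ r ((s , h) ∷ x) =
      trans (+-cong (*-assoc r s _) (evaluate-scale φ r x)) (sym (distribˡ r _ _))

    coefficient-scale : ∀ r x g → coef (List.map (map₁ (r *_)) x) g ≈ r * coef x g
    coefficient-scale r x g = trans (coefficient-evaluate (List.map (map₁ (r *_)) x) g)
      (trans (evaluate-scale _ r x) (*-congˡ (sym (coefficient-evaluate x g))))

    away : B.Carrier → FormalSum R B.Carrier → FormalSum R B.Carrier
    away g = List.filter λ (_ , h) → ¬? (h B.≟ g)

    evaluate-away : ∀ {φ} → Respects φ → ∀ g x →
                    evaluate φ x ≈ coef x g * φ g + evaluate φ (away g x)
    evaluate-away φ-resp g [] = sym (trans (+-identityʳ _) (zeroˡ _))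
    evaluate-away {φ} φ-resp g ((r , h) ∷ x) with h B.≟ g
    ... | yes h≈g = begin
      r * φ h + evaluate φ x
        ≈⟨ +-cong (*-congˡ (φ-resp h≈g)) (evaluate-away φ-resp g x) ⟩
      r * φ g + (coef x g * φ g + evaluate φ (away g x))
        ≈⟨ sym (+-assoc _ _ _) ⟩
      (r * φ g + coef x g * φ g) + evaluate φ (away g x)
        ≈⟨ +-congʳ (sym (distribʳ _ _ _)) ⟩
      (r + coef x g) * φ g + evaluate φ (away g x) ∎
    ... | no h≉g = begin
      r * φ h + evaluate φ x
        ≈⟨ +-congˡ (evaluate-away φ-resp g x) ⟩
      r * φ h + (coef x g * φ g + evaluate φ (away g x))
        ≈⟨ +-swap _ _ _ ⟩
      coef x g * φ g + (r * φ h + evaluate φ (away g x))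
        ≈⟨ +-congʳ (*-congʳ (sym (+-identityˡ _))) ⟩
      (0# + coef x g) * φ g + (r * φ h + evaluate φ (away g x)) ∎

    -- Collecting the terms ≈ g leaves a shorter sum that still vanishes.
    evaluate-zero : ∀ {φ} → Respects φ → ∀ m x → List.length x ℕ.≤ m →
                    (∀ g → coef x g ≈ 0#) → evaluate φ x ≈ 0#
    evaluate-zero         φ-resp m       []            _         x≋0 = refl
    evaluate-zero {φ = φ} φ-resp (suc m) ((r , g) ∷ x) (ℕ.s≤s le) x≋0 = trans (collect φ-resp)
      (evaluate-zero φ-resp m (away g x)
        (ℕ.≤-trans (List.length-filter (λ (_ , h) → ¬? (h B.≟ g)) x) le) λ h →
        trans (coefficient-evaluate (away g x) h)
          (trans (sym (collect (indicator-respects h)))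
            (trans (sym (coefficient-evaluate ((r , g) ∷ x) h)) (x≋0 h))))
      where
      r+x≈0 : r + coef x g ≈ 0#
      r+x≈0 = trans (+-congʳ (sym (trans (if-indicator (g B.≟ g) r)
        (indicator-*-yes (g B.≟ g) B.refl)))) (x≋0 g)
      collect : ∀ {ψ} → Respects ψ → r * ψ g + evaluate ψ x ≈ evaluate ψ (away g x)
      collect {ψ} ψ-resp = begin
        r * ψ g + evaluate ψ x
          ≈⟨ +-congˡ (evaluate-away ψ-resp g x) ⟩
        r * ψ g + (coef x g * ψ g + evaluate ψ (away g x))
          ≈⟨ sym (+-assoc _ _ _) ⟩
        (r * ψ g + coef x g * ψ g) + evaluate ψ (away g x)
          ≈⟨ +-congʳ (sym (distribʳ _ _ _)) ⟩
        (r + coef x g) * ψ g + evaluate ψ (away g x)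
          ≈⟨ +-congʳ (trans (*-congʳ r+x≈0) (zeroˡ _)) ⟩
        0# + evaluate ψ (away g x)
          ≈⟨ +-identityˡ _ ⟩
        evaluate ψ (away g x) ∎

    -- Formal sums are compared through their coefficients, so it is not automatic that a
    -- functional, defined by running through the terms, respects the comparison. The claim is
    -- `evaluate-zero` for the difference of `x` and `y`.
    evaluate-cong : ∀ {φ} → Respects φ → ∀ {x y} → x ≋ y → evaluate φ x ≈ evaluate φ y
    evaluate-cong {φ} φ-resp {x} {y} x≋y = begin
      evaluate φ x
        ≈⟨ sym (+-identityʳ _) ⟩
      evaluate φ x + 0#
        ≈⟨ +-congˡ (sym (trans (+-congʳ (-1*x≈-x _)) (-‿inverseˡ _))) ⟩
      evaluate φ x + (- 1# * evaluate φ y + evaluate φ y)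
        ≈⟨ sym (+-assoc _ _ _) ⟩
      (evaluate φ x + - 1# * evaluate φ y) + evaluate φ y
        ≈⟨ +-congʳ (sym (trans (∑-++ x -y _) (+-congˡ (evaluate-scale φ (- 1#) y)))) ⟩
      evaluate φ (x ++ -y) + evaluate φ y
        ≈⟨ +-congʳ (evaluate-zero φ-resp _ (x ++ -y) ℕ.≤-refl difference≋0) ⟩
      0# + evaluate φ y
        ≈⟨ +-identityˡ _ ⟩
      evaluate φ y ∎
      where
      -y : FormalSum R B.Carrier
      -y = List.map (map₁ (- 1# *_)) y
      difference≋0 : ∀ g → coef (x ++ -y) g ≈ 0#
      difference≋0 g = trans (coefficient-++ x -y g) (trans
        (+-cong (x≋y g) (trans (coefficient-scale (- 1#) y g) (-1*x≈-x _))) (-‿inverseʳ _))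

    coefficient-linearExtension : (f : A → FormalSum R B.Carrier) → ∀ x g →
      coef (linearExtension R f x) g ≈ evaluate (λ h → coef (f h) g) x
    coefficient-linearExtension f []            g = refl
    coefficient-linearExtension f ((r , h) ∷ x) g = trans
      (coefficient-++ (List.map (map₁ (r *_)) (f h)) _ g)
      (+-cong (coefficient-scale r (f h) g) (coefficient-linearExtension f x g))

    coefficient-concatMap : (f : A → FormalSum R B.Carrier) → ∀ xs g →
      coef (concatMap f xs) g ≈ ∑ xs (λ x → coef (f x) g)
    coefficient-concatMap f []       g = refl
    coefficient-concatMap f (x ∷ xs) g = trans (coefficient-++ (f x) _ g)
      (+-congˡ (coefficient-concatMap f xs g))

    coefficient-sumOf : (f : A → B.Carrier) → ∀ xs g →
      coef (sumOf R (List.map f xs)) g ≈ ∑ xs (λ x → ⟦ f x B.≟ g ⟧)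
    coefficient-sumOf f []       g = refl
    coefficient-sumOf f (x ∷ xs) g = +-congˡ (coefficient-sumOf f xs g)

    module _ (mul : B.Carrier → B.Carrier → FormalSum R B.Carrier) where
      private
        infixl 7 _⊛_
        _⊛_ : FormalSum R B.Carrier → FormalSum R B.Carrier → FormalSum R B.Carrier
        _⊛_ = bilinearExtension R mul

      coefficient-bilinear : ∀ x y g →
        coef (x ⊛ y) g ≈ evaluate (λ h → evaluate (λ k → coef (mul h k) g) y) x
      coefficient-bilinear x y g = trans
        (coefficient-linearExtension (λ h → linearExtension R (mul h) y) x g)
        (∑-cong x λ (r , h) → *-congˡ (coefficient-linearExtension (mul h) y g))

      bilinear-cong : (∀ {h h′ k k′} → h B.≈ h′ → k B.≈ k′ → mul h k ≋ mul h′ k′) →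
                      ∀ {x x′ y y′} → x ≋ x′ → y ≋ y′ → x ⊛ y ≋ x′ ⊛ y′
      bilinear-cong mul-cong {x} {x′} {y} {y′} x≋x′ y≋y′ g = begin
        coef (x ⊛ y) g
          ≈⟨ coefficient-bilinear x y g ⟩
        evaluate (λ h → evaluate (λ k → coef (mul h k) g) y) x
          ≈⟨ ∑-cong x (λ (r , h) → *-congˡ (evaluate-cong
               (λ k≈k′ → mul-cong (B.refl {h}) k≈k′ g) {y} {y′} y≋y′)) ⟩
        evaluate (λ h → evaluate (λ k → coef (mul h k) g) y′) x
          ≈⟨ evaluate-cong (λ h≈h′ → ∑-cong y′ λ (s , k) →
               *-congˡ (mul-cong h≈h′ (B.refl {k}) g)) {x} {x′} x≋x′ ⟩
        evaluate (λ h → evaluate (λ k → coef (mul h k) g) y′) x′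
          ≈⟨ sym (coefficient-bilinear x′ y′ g) ⟩
        coef (x′ ⊛ y′) g ∎

      bilinear-zeroʳ : ∀ x → x ⊛ [] ≋ []
      bilinear-zeroʳ x g = trans (coefficient-bilinear x [] g) (∑-zero x λ _ → zeroʳ _)

      bilinear-distribˡ : ∀ x y z → x ⊛ (y ++ z) ≋ x ⊛ y ++ x ⊛ z
      bilinear-distribˡ x y z g = begin
        coef (x ⊛ (y ++ z)) g
          ≈⟨ coefficient-bilinear x (y ++ z) g ⟩
        evaluate (λ h → evaluate (λ k → coef (mul h k) g) (y ++ z)) x
          ≈⟨ ∑-cong x (λ (r , h) → trans (*-congˡ (∑-++ y z _)) (distribˡ r _ _)) ⟩
        ∑ x (λ (r , h) → r * evaluate (λ k → coef (mul h k) g) y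
                       + r * evaluate (λ k → coef (mul h k) g) z)
          ≈⟨ ∑-distrib-+ x _ _ ⟩
        evaluate (λ h → evaluate (λ k → coef (mul h k) g) y) x
          + evaluate (λ h → evaluate (λ k → coef (mul h k) g) z) x
          ≈⟨ +-cong (sym (coefficient-bilinear x y g)) (sym (coefficient-bilinear x z g)) ⟩
        coef (x ⊛ y) g + coef (x ⊛ z) g
          ≈⟨ sym (coefficient-++ (x ⊛ y) (x ⊛ z) g) ⟩
        coef (x ⊛ y ++ x ⊛ z) g ∎

      module _ {P : FormalSum R B.Carrier → Set ℓp} (≋-closed : ∀ {x y} → x ≋ y → P x → P y)
               ([]-closed : P []) (++-closed : ∀ {x y} → P x → P y → P (x ++ y)) where

        -- Reduces a statement on products to products of spanning elements. The product is additive
        -- on the left by computation with lists, but on the right only up to `≋`, whence the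
        -- closure hypothesis on `P`. It serves both products: in `FQSym` with `P` the combinations
        -- of block sums, in the group algebra with `P` the component `Symₙ`.
        bilinear-closed : (f : A → FormalSum R B.Carrier) → (∀ s t → P (f s ⊛ f t)) →
          ∀ xs ys → P (concatMap f xs ⊛ concatMap f ys)
        bilinear-closed f closed []       ys = []-closed
        bilinear-closed f closed (s ∷ xs) ys =
          ≡.subst P (≡.sym (List.concatMap-++ _ (f s) (concatMap f xs)))
            (++-closed (row ys) (bilinear-closed f closed xs ys))
          where
          row : ∀ ys → P (f s ⊛ concatMap f ys)
          row []       = ≋-closed (λ g → sym (bilinear-zeroʳ (f s) g)) []-closed
          row (t ∷ ys) = ≋-closed (λ g → sym (bilinear-distribˡ (f s) (f t) (concatMap f ys) g))
            (++-closed (closed s t) (row ys))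

-- Block sums and their products in FQSym

module Blocks (R : CommutativeRing c ℓ) (l : ℕ) where
  open CommutativeRing R renaming (Carrier to K) hiding (zero)
  open Sums R
  open import Algebra.Properties.CommutativeSemigroup *-commutativeSemigroup
    using () renaming (interchange to *-interchange)
  open import Relation.Binary.Reasoning.Setoid setoid
  module CP {n} = DecSetoid (coloredDecSetoid l n)
  coef : FormalSum R (ColoredPermutation l n) → ColoredPermutation l n → K
  coef {n} = coefficient R (coloredDecSetoid l n)
  coefₛ : RawAlgebra.Carrier (FQSym R l) → ∃ (ColoredPermutation l) → K
  coefₛ = coefficient R (allSizesDecSetoid l)
  infix 4 _≋ₛ_
  _≋ₛ_ : RawAlgebra.Carrier (FQSym R l) → RawAlgebra.Carrier (FQSym R l) → Set _
  _≋ₛ_ = _≋_ (allSizesDecSetoid l)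
  infix 4 _≟_
  _≟_ : (x y : ∃ (ColoredPermutation l)) → Dec (_≈ₛ_ l x y)
  _≟_ = _≟ₛ_ l

  module _ (B : DecSetoid ℓa ℓb) where
    private module B = DecSetoid B

    fromFunction : List B.Carrier → (B.Carrier → K) → FormalSum R B.Carrier
    fromFunction xs f = List.map (λ g → f g , g) xs

    coefficient-fromFunction : ∀ xs → Enumerates B xs → ∀ {f} → Respects B f → ∀ g →
      coefficient R B (fromFunction xs f) g ≈ f g
    coefficient-fromFunction xs enum {f} f-resp g = begin
      coefficient R B (fromFunction xs f) g
        ≈⟨ coefficient-evaluate B (fromFunction xs f) g ⟩
      ∑ (fromFunction xs f) (λ (r , h) → r * ⟦ h B.≟ g ⟧)
        ≈⟨ ∑-map (λ h → f h , h) xs _ ⟩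
      ∑ xs (λ h → f h * ⟦ h B.≟ g ⟧)
        ≈⟨ ∑-single B xs enum g
             (λ h h≈g → trans (*-congˡ (indicator-yes (h B.≟ g) h≈g)) (trans (*-identityʳ _) (f-resp h≈g)))
             (λ h h≉g → trans (*-congˡ (indicator-no (h B.≟ g) h≉g)) (zeroʳ _)) ⟩
      f g ∎

  -- (σ , u) has coefficient weight u if σ increases on the blocks of label, and
  -- 0 otherwise; weight depends only on the number of letters of each color in
  -- each block.  These sums span the degree n component of Sym.
  record Block (n : ℕ) : Set (c Level.⊔ ℓ) where
    field
      {blocks}  : ℕ
      label     : Fin n → Fin blocks
      monotone  : Monotone label
      weight    : Vec (Fin l) n → K
      symmetric : ∀ {u v} → SameContent label u v → weight u ≈ weight v

    blockCoefficient : ColoredPermutation l n → K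
    blockCoefficient (σ , u) = ⟦ increasingOnBlocks? label (σ ⟨$⟩ʳ_) ⟧ * weight u

    blockCoefficient-respects : Respects (coloredDecSetoid l n) blockCoefficient
    blockCoefficient-respects {σ , u} {τ , _} (σ≈τ , ≡.refl) = *-congʳ (indicator-⇔
      (mk⇔ (increasing-cong (λ _ → ≡.refl) σ≈τ)
           (increasing-cong (λ _ → ≡.refl) (λ x → ≡.sym (σ≈τ x))))
      (increasingOnBlocks? label (σ ⟨$⟩ʳ_)) (increasingOnBlocks? label (τ ⟨$⟩ʳ_)))

    blockSum : FQSymₙ R l n
    blockSum = fromFunction (coloredDecSetoid l n) (allColored l n) blockCoefficient

    coefficient-blockSum : ∀ h → coef blockSum h ≈ blockCoefficient h
    coefficient-blockSum = coefficient-fromFunction (coloredDecSetoid l n) (allColored l n)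
      (enumerates-allColored l n) (λ {g} {h} → blockCoefficient-respects {g} {h})

  open Block using (label; weight; blockSum; blockCoefficient; coefficient-blockSum)

  indicator-sameSize : (g h : ColoredPermutation l n) → ⟦ (n , g) ≟ (n , h) ⟧ ≈ ⟦ g CP.≟ h ⟧
  indicator-sameSize g h =
    indicator-⇔ (mk⇔ (λ { (sameSize e) → e }) sameSize) ((_ , g) ≟ (_ , h)) (g CP.≟ h)

  indicator-≢size : m ≢ n → (g : ColoredPermutation l m) (h : ColoredPermutation l n) →
                    ⟦ (m , g) ≟ (n , h) ⟧ ≈ 0#
  indicator-≢size m≢n g h = indicator-no ((_ , g) ≟ (_ , h)) λ { (sameSize _) → m≢n ≡.refl }

  evaluate-inclusion : ∀ φ (x : FQSymₙ R l n) →
    evaluate φ (inclusion R l n x) ≈ evaluate (λ h → φ (n , h)) x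
  evaluate-inclusion φ []            = refl
  evaluate-inclusion φ ((r , h) ∷ x) = +-cong (*-congʳ (*-identityʳ r)) (evaluate-inclusion φ x)

  coefficient-inclusion : ∀ (x : FQSymₙ R l n) h → coefₛ (inclusion R l n x) (n , h) ≈ coef x h
  coefficient-inclusion {n} x h = begin
    coefₛ (inclusion R l n x) (n , h)
      ≈⟨ coefficient-evaluate (allSizesDecSetoid l) (inclusion R l n x) (n , h) ⟩
    evaluate (λ g → ⟦ g ≟ (n , h) ⟧) (inclusion R l n x)
      ≈⟨ evaluate-inclusion (λ g → ⟦ g ≟ (n , h) ⟧) x ⟩
    evaluate (λ g → ⟦ (n , g) ≟ (n , h) ⟧) x
      ≈⟨ ∑-cong x (λ (r , g) → *-congˡ (indicator-sameSize g h)) ⟩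
    evaluate (λ g → ⟦ g CP.≟ h ⟧) x
      ≈⟨ sym (coefficient-evaluate (coloredDecSetoid l n) x h) ⟩
    coef x h ∎

  coefficient-inclusion-≢ : n ≢ m → ∀ (x : FQSymₙ R l n) (h : ColoredPermutation l m) →
                            coefₛ (inclusion R l n x) (m , h) ≈ 0#
  coefficient-inclusion-≢ {n} {m} n≢m x h = begin
    coefₛ (inclusion R l n x) (m , h)
      ≈⟨ coefficient-evaluate (allSizesDecSetoid l) (inclusion R l n x) (m , h) ⟩
    evaluate (λ g → ⟦ g ≟ (m , h) ⟧) (inclusion R l n x)
      ≈⟨ evaluate-inclusion (λ g → ⟦ g ≟ (m , h) ⟧) x ⟩
    evaluate (λ g → ⟦ (n , g) ≟ (m , h) ⟧) x
      ≈⟨ ∑-zero x (λ (r , g) → trans (*-congˡ (indicator-≢size n≢m g h)) (zeroʳ r)) ⟩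
    0# ∎

  inclusion-cong : ∀ {x y : FQSymₙ R l n} → _≋_ (coloredDecSetoid l n) x y →
                   inclusion R l n x ≋ₛ inclusion R l n y
  inclusion-cong {n} {x} {y} x≋y (m , h) with n ℕ.≟ m
  ... | yes ≡.refl = trans (coefficient-inclusion x h) (trans (x≋y h) (sym (coefficient-inclusion y h)))
  ... | no  n≢m    = trans (coefficient-inclusion-≢ n≢m x h) (sym (coefficient-inclusion-≢ n≢m y h))

  ι : Block n → RawAlgebra.Carrier (FQSym R l)
  ι {n} A = inclusion R l n (blockSum A)

  coefficient-ι : ∀ (A : Block n) h → coefₛ (ι A) (n , h) ≈ blockCoefficient A h
  coefficient-ι A h = trans (coefficient-inclusion (blockSum A) h) (coefficient-blockSum A h)

  mul : (g h : ∃ (ColoredPermutation l)) → RawAlgebra.Carrier (FQSym R l)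
  mul (i , σ , u) (j , τ , v) =
    sumOf R (List.map (λ ρ → i ℕ.+ j , ρ , u Vec.++ v) (convolution σ τ))

  leftPart : Permutation′ (i ℕ.+ j) → Fin i → Fin (i ℕ.+ j)
  leftPart {i} {j} ρ x = ρ ⟨$⟩ʳ (x Fin.↑ˡ j)

  rightPart : Permutation′ (i ℕ.+ j) → Fin j → Fin (i ℕ.+ j)
  rightPart {i} ρ y = ρ ⟨$⟩ʳ (i Fin.↑ʳ y)

  standardizesBoth? : (ρ : Permutation′ (i ℕ.+ j)) (σ : Permutation′ i) (τ : Permutation′ j) →
    Dec (StandardizesTo (leftPart ρ) σ × StandardizesTo (rightPart ρ) τ)
  standardizesBoth? ρ σ τ = standardizesTo? (leftPart ρ) σ ×-dec standardizesTo? (rightPart ρ) τ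

  standardizesBoth-cong : ∀ {ρ ρ′ : Permutation′ (i ℕ.+ j)} {σ σ′ : Permutation′ i} {τ τ′ : Permutation′ j} →
    ρ Perm.≈ ρ′ → σ Perm.≈ σ′ → τ Perm.≈ τ′ →
    ⟦ standardizesBoth? ρ σ τ ⟧ ≈ ⟦ standardizesBoth? ρ′ σ′ τ′ ⟧
  standardizesBoth-cong {ρ = ρ} {ρ′} {σ} {σ′} {τ} {τ′} ρ≈ σ≈ τ≈ = indicator-⇔ (mk⇔
    (λ (stdˡ , stdʳ) →
      standardizesTo-cong (leftPart ρ) (leftPart ρ′) σ σ′ (λ x → ρ≈ _) σ≈ stdˡ ,
      standardizesTo-cong (rightPart ρ) (rightPart ρ′) τ τ′ (λ y → ρ≈ _) τ≈ stdʳ)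
    (λ (stdˡ , stdʳ) →
      standardizesTo-cong (leftPart ρ′) (leftPart ρ) σ′ σ (λ x → ≡.sym (ρ≈ _)) (λ x → ≡.sym (σ≈ x)) stdˡ ,
      standardizesTo-cong (rightPart ρ′) (rightPart ρ) τ′ τ (λ y → ≡.sym (ρ≈ _)) (λ y → ≡.sym (τ≈ y)) stdʳ))
    (standardizesBoth? ρ σ τ) (standardizesBoth? ρ′ σ′ τ′)

  -- The permutation ρ counts once in `allPermutations`, so the sum over `convolution` turns into a
  -- test on ρ itself.
  coefficient-mul : ∀ (g : ColoredPermutation l i) (h : ColoredPermutation l j) ρ e →
    coefₛ (mul (i , g) (j , h)) (i ℕ.+ j , ρ , e) ≈
    ⟦ standardizesBoth? ρ (proj₁ g) (proj₁ h) ⟧ * ⟦ Vec.≡-dec Fin._≟_ (proj₂ g Vec.++ proj₂ h) e ⟧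
  coefficient-mul {i} {j} (σ , u) (τ , v) ρ e = begin
    coefₛ (mul (i , σ , u) (j , τ , v)) (i ℕ.+ j , ρ , e)
      ≈⟨ coefficient-sumOf (allSizesDecSetoid l) _ (convolution σ τ) _ ⟩
    ∑ (convolution σ τ) (λ π → ⟦ (i ℕ.+ j , π , w) ≟ (i ℕ.+ j , ρ , e) ⟧)
      ≈⟨ ∑-filter (λ π → standardizesBoth? π σ τ) (allPermutations (i ℕ.+ j)) _ ⟩
    ∑ (allPermutations (i ℕ.+ j))
      (λ π → ⟦ standardizesBoth? π σ τ ⟧ * ⟦ (i ℕ.+ j , π , w) ≟ (i ℕ.+ j , ρ , e) ⟧)
      ≈⟨ ∑-single (permutationDecSetoid (i ℕ.+ j)) (allPermutations (i ℕ.+ j))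
           (enumerates-allPermutations (i ℕ.+ j)) ρ
           (λ π π≈ρ → *-cong
             (standardizesBoth-cong {ρ = π} {ρ} {σ} {σ} {τ} {τ} π≈ρ (λ _ → ≡.refl) (λ _ → ≡.refl))
             (trans (indicator-sameSize (π , w) (ρ , e)) (indicator-⇔ (mk⇔ proj₂ (π≈ρ ,_))
               ((π , w) CP.≟ (ρ , e)) (Vec.≡-dec Fin._≟_ w e))))
           (λ π π≉ρ → trans (*-congˡ (trans (indicator-sameSize (π , w) (ρ , e))
             (indicator-no ((π , w) CP.≟ (ρ , e)) (π≉ρ ∘ proj₁)))) (zeroʳ _)) ⟩
    ⟦ standardizesBoth? ρ σ τ ⟧ * ⟦ Vec.≡-dec Fin._≟_ w e ⟧ ∎
    where
    w : Vec (Fin l) (i ℕ.+ j)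
    w = u Vec.++ v

  coefficient-mul-≢ : i ℕ.+ j ≢ m → ∀ (g : ColoredPermutation l i) (h : ColoredPermutation l j)
    (k : ColoredPermutation l m) → coefₛ (mul (i , g) (j , h)) (m , k) ≈ 0#
  coefficient-mul-≢ i+j≢m (σ , u) (τ , v) k = trans
    (coefficient-sumOf (allSizesDecSetoid l) _ (convolution σ τ) _)
    (∑-zero (convolution σ τ) λ π → indicator-≢size i+j≢m (π , u Vec.++ v) k)

  mul-cong : ∀ {g g′ h h′} → _≈ₛ_ l g g′ → _≈ₛ_ l h h′ → mul g h ≋ₛ mul g′ h′
  mul-cong (sameSize {i} {g@(σ , u)} {g′@(σ′ , _)} (σ≈ , ≡.refl))
           (sameSize {j} {h@(τ , v)} {h′@(τ′ , _)} (τ≈ , ≡.refl)) (m , ρ , e) with i ℕ.+ j ℕ.≟ m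
  ... | yes ≡.refl = trans (coefficient-mul g h ρ e) (trans
    (*-congʳ (standardizesBoth-cong {ρ = ρ} {ρ} {σ} {σ′} {τ} {τ′} (λ _ → ≡.refl) σ≈ τ≈))
    (sym (coefficient-mul g′ h′ ρ e)))
  ... | no i+j≢m = trans (coefficient-mul-≢ i+j≢m g h (ρ , e))
                         (sym (coefficient-mul-≢ i+j≢m g′ h′ (ρ , e)))

  infixl 7 _⋆_
  _⋆_ : (x y : RawAlgebra.Carrier (FQSym R l)) → RawAlgebra.Carrier (FQSym R l)
  _⋆_ = RawAlgebra._*_ (FQSym R l)

  ⋆-cong : ∀ {x x′ y y′} → x ≋ₛ x′ → y ≋ₛ y′ → x ⋆ y ≋ₛ x′ ⋆ y′
  ⋆-cong {x} {x′} {y} {y′} = bilinear-cong (allSizesDecSetoid l) mul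
    (λ {g} {g′} {h} {h′} → mul-cong {g} {g′} {h} {h′}) {x} {x′} {y} {y′}

  take-++ : ∀ (u : Vec (Fin l) i) (v : Vec (Fin l) j) → Vec.take i (u Vec.++ v) ≡ u
  take-++ {i} u v = Vec.++-injectiveˡ (Vec.take i (u Vec.++ v)) u (Vec.take++drop≡id i (u Vec.++ v))

  drop-++ : ∀ (u : Vec (Fin l) i) (v : Vec (Fin l) j) → Vec.drop i (u Vec.++ v) ≡ v
  drop-++ {i} u v = Vec.++-injectiveʳ (Vec.take i (u Vec.++ v)) u (Vec.take++drop≡id i (u Vec.++ v))

  juxtapose : Block i → Block j → Block (i ℕ.+ j)
  juxtapose {i} A B = record
    { label     = label A ⊔ˡ label B
    ; monotone  = ⊔ˡ-monotone (Block.monotone A) (Block.monotone B)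
    ; weight    = λ e → weight A (Vec.take i e) * weight B (Vec.drop i e)
    ; symmetric = λ {u} {v} same →
        let sameˡ , sameʳ = Equivalence.to (sameContent-⊔ˡ (label A) (label B)
                  {Vec.take i u} {Vec.take i v} {Vec.drop i u} {Vec.drop i v})
              (≡.subst₂ (SameContent (label A ⊔ˡ label B))
                (≡.sym (Vec.take++drop≡id i u)) (≡.sym (Vec.take++drop≡id i v)) same)
        in *-cong (Block.symmetric A {Vec.take i u} {Vec.take i v} sameˡ)
                  (Block.symmetric B {Vec.drop i u} {Vec.drop i v} sameʳ)
    }

  evaluate-ι : ∀ φ (A : Block n) →
    evaluate φ (ι A) ≈ ∑ (allColored l n) (λ g → blockCoefficient A g * φ (n , g))
  evaluate-ι {n} φ A = trans (evaluate-inclusion φ (blockSum A))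
    (∑-map (λ g → blockCoefficient A g , g) (allColored l n) (λ (r , g) → r * φ (n , g)))

  coefficient-ι-⋆ : ∀ (A : Block i) (B : Block j) k → coefₛ (ι A ⋆ ι B) k ≈
    ∑ (allColored l i) (λ g → blockCoefficient A g *
      ∑ (allColored l j) (λ h → blockCoefficient B h * coefₛ (mul (i , g) (j , h)) k))
  coefficient-ι-⋆ {i} {j} A B k = trans (coefficient-bilinear (allSizesDecSetoid l) mul (ι A) (ι B) k)
    (trans (evaluate-ι (λ g → evaluate (λ h → coefₛ (mul g h) k) (ι B)) A)
      (∑-cong (allColored l i) λ g → *-congˡ (evaluate-ι (λ h → coefₛ (mul (i , g) h) k) B)))

  -- At (ρ, u ++ v) a single pair of factors contributes: the standardizations of the two halves of
  -- ρ, colored by `u` and `v`. By `increasing-⊔ˡ` their block conditions together are the one on ρ.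
  ι-juxtapose : ∀ (A : Block i) (B : Block j) → ι A ⋆ ι B ≋ₛ ι (juxtapose A B)
  ι-juxtapose {i} {j} A B (m , ρ , e) with i ℕ.+ j ℕ.≟ m
  ... | no i+j≢m = trans (coefficient-ι-⋆ A B (m , ρ , e)) (trans
    (∑-zero (allColored l i) λ g → trans (*-congˡ (∑-zero (allColored l j) λ h →
      trans (*-congˡ (coefficient-mul-≢ i+j≢m g h (ρ , e))) (zeroʳ _))) (zeroʳ _))
    (sym (coefficient-inclusion-≢ i+j≢m (blockSum (juxtapose A B)) (ρ , e))))
  ... | yes ≡.refl with Vec.splitAt i e
  ...   | u , v , ≡.refl = begin
    coefₛ (ι A ⋆ ι B) (i ℕ.+ j , ρ , e)
      ≈⟨ coefficient-ι-⋆ A B (i ℕ.+ j , ρ , e) ⟩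
    ∑ (allColored l i) (λ g → blockCoefficient A g *
      ∑ (allColored l j) (λ h → blockCoefficient B h * coefₛ (mul (i , g) (j , h)) (i ℕ.+ j , ρ , e)))
      ≈⟨ ∑-cong (allColored l i) (λ g → *-congˡ (∑-cong (allColored l j) λ h →
           *-congˡ (coefficient-mul g h ρ e))) ⟩
    ∑ (allColored l i) (λ g → blockCoefficient A g *
      ∑ (allColored l j) (λ h → blockCoefficient B h * matches g h))
      ≈⟨ ∑-single (coloredDecSetoid l i) (allColored l i) (enumerates-allColored l i) (σ , u)
           (λ g g≈ → *-cong (Block.blockCoefficient-respects A {g} {σ , u} g≈) (inner g g≈))
           (λ g g≉ → trans (*-congˡ (∑-zero (allColored l j) λ h →
              trans (*-congˡ (matches-no g h (g≉ ∘ proj₁))) (zeroʳ _))) (zeroʳ _)) ⟩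
    blockCoefficient A (σ , u) * blockCoefficient B (τ , v)
      ≈⟨ *-interchange _ _ _ _ ⟩
    (⟦ increasingOnBlocks? (label A) (σ ⟨$⟩ʳ_) ⟧ * ⟦ increasingOnBlocks? (label B) (τ ⟨$⟩ʳ_) ⟧)
      * (weight A u * weight B v)
      ≈⟨ *-cong (trans (sym (indicator-×
             (increasingOnBlocks? (label A) (σ ⟨$⟩ʳ_)) (increasingOnBlocks? (label B) (τ ⟨$⟩ʳ_))))
           (indicator-⇔ (mk⇔ (Equivalence.from both) (Equivalence.to both))
           (increasingOnBlocks? (label A) (σ ⟨$⟩ʳ_) ×-dec increasingOnBlocks? (label B) (τ ⟨$⟩ʳ_))
           (increasingOnBlocks? (label A ⊔ˡ label B) (ρ ⟨$⟩ʳ_))))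
           (*-cong (reflexive (≡.cong (weight A) (≡.sym (take-++ u v))))
                   (reflexive (≡.cong (weight B) (≡.sym (drop-++ u v))))) ⟩
    blockCoefficient (juxtapose A B) (ρ , e)
      ≈⟨ sym (coefficient-ι (juxtapose A B) (ρ , e)) ⟩
    coefₛ (ι (juxtapose A B)) (i ℕ.+ j , ρ , e) ∎
    where
    stdˡ : ∃ (StandardizesTo (leftPart ρ))
    stdˡ = standardize _ (λ eq → Fin.↑ˡ-injective j _ _ (perm-injective ρ eq))
    stdʳ : ∃ (StandardizesTo (rightPart ρ))
    stdʳ = standardize _ (λ eq → Fin.↑ʳ-injective i _ _ (perm-injective ρ eq))
    σ = proj₁ stdˡ
    τ = proj₁ stdʳ
    both : IncreasingOnBlocks (label A ⊔ˡ label B) (ρ ⟨$⟩ʳ_) ⇔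
           (IncreasingOnBlocks (label A) (σ ⟨$⟩ʳ_) × IncreasingOnBlocks (label B) (τ ⟨$⟩ʳ_))
    both = increasing-⊔ˡ {w = ρ ⟨$⟩ʳ_} {σ} {τ} (proj₂ stdˡ) (proj₂ stdʳ)
    matches : ColoredPermutation l i → ColoredPermutation l j → K
    matches g h = ⟦ standardizesBoth? ρ (proj₁ g) (proj₁ h) ⟧
                * ⟦ Vec.≡-dec Fin._≟_ (proj₂ g Vec.++ proj₂ h) (u Vec.++ v) ⟧
    matches-yes : ∀ g h → g CP.≈ (σ , u) → h CP.≈ (τ , v) → matches g h ≈ 1#
    matches-yes (σ′ , _) (τ′ , _) (σ′≈σ , ≡.refl) (τ′≈τ , ≡.refl) = trans
      (*-cong (indicator-yes (standardizesBoth? ρ σ′ τ′)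
                ( standardizesTo-cong (leftPart ρ) (leftPart ρ) σ σ′
                    (λ _ → ≡.refl) (λ x → ≡.sym (σ′≈σ x)) (proj₂ stdˡ)
                , standardizesTo-cong (rightPart ρ) (rightPart ρ) τ τ′
                    (λ _ → ≡.refl) (λ y → ≡.sym (τ′≈τ y)) (proj₂ stdʳ)))
              (indicator-yes (Vec.≡-dec Fin._≟_ (u Vec.++ v) (u Vec.++ v)) ≡.refl))
      (*-identityˡ 1#)
    matches-no : ∀ g h → ¬ (g CP.≈ (σ , u) × h CP.≈ (τ , v)) → matches g h ≈ 0#
    matches-no (σ′ , u′) (τ′ , v′) ¬both
      with Vec.≡-dec Fin._≟_ (u′ Vec.++ v′) (u Vec.++ v)
    ... | no _ = zeroʳ _
    ... | yes eq with Vec.++-injective u′ u eq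
    ...   | ≡.refl , ≡.refl = indicator-*-no (standardizesBoth? ρ σ′ τ′) λ (isˡ , isʳ) → ¬both
      ( (standardization-unique σ′ σ isˡ (proj₂ stdˡ) , ≡.refl)
      , (standardization-unique τ′ τ isʳ (proj₂ stdʳ) , ≡.refl))
    inner : ∀ g → g CP.≈ (σ , u) →
      ∑ (allColored l j) (λ h → blockCoefficient B h * matches g h) ≈ blockCoefficient B (τ , v)
    inner g g≈ = ∑-single (coloredDecSetoid l j) (allColored l j) (enumerates-allColored l j) (τ , v)
      (λ h h≈ → trans (*-cong (Block.blockCoefficient-respects B {h} {τ , v} h≈) (matches-yes g h g≈ h≈))
                      (*-identityʳ _))
      (λ h h≉ → trans (*-congˡ (matches-no g h (h≉ ∘ proj₂))) (zeroʳ _))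

-- Block sums span Sym

module Span (R : CommutativeRing c ℓ) (l : ℕ) where
  open CommutativeRing R renaming (Carrier to K) hiding (zero)
  open Sums R
  open Blocks R l
  open Block using (label; weight; blockSum; blockCoefficient; coefficient-blockSum)
  open import Algebra.Properties.CommutativeSemigroup *-commutativeSemigroup
    using () renaming (x∙yz≈y∙xz to *-swap)
  open import Relation.Binary.Reasoning.Setoid setoid

  -- The size n is independent of `𝐧`. If it equals the total of `𝐧`, this is the generator `S 𝐧`;
  -- otherwise no word has the content and the block sum is zero.
  contentBlock : Vec ℕ l → Block n
  contentBlock 𝐧 = record
    { label     = allZero
    ; monotone  = λ _ _ _ → ℕ.z≤n
    ; weight    = λ u → ⟦ hasContent? 𝐧 u ⟧
    ; symmetric = λ {u} {v} same → indicator-⇔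
        (mk⇔ (hasContent-sameContent {𝐧 = 𝐧} {u} {v} same)
             (hasContent-sameContent {𝐧 = 𝐧} {v} {u} (λ z → ≡.sym (same z))))
        (hasContent? 𝐧 u) (hasContent? 𝐧 v)
    }

  id≈⇔increasing : (σ : Permutation′ n) → (Perm.id Perm.≈ σ) ⇔ IncreasingOnBlocks allZero (σ ⟨$⟩ʳ_)
  id≈⇔increasing σ = mk⇔
    (λ id≈σ x y x<y _ → ≡.subst₂ Fin._<_ (id≈σ x) (id≈σ y) x<y)
    (blockIncreasing-unique allZero Perm.id σ (λ _ → ≡.refl) (λ _ _ x<y _ → x<y))

  -- The identity is the only permutation that increases on a single block, and it is the only one
  -- occurring in `S 𝐧`.
  ι-content : (𝐧 : Vec ℕ l) → Vec.sum 𝐧 ≡ n → S R l 𝐧 ≋ₛ ι (contentBlock {n} 𝐧)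
  ι-content {n} 𝐧 ≡.refl (m , ρ , e) with n ℕ.≟ m
  ... | no n≢m = begin
    coefₛ (S R l 𝐧) (m , ρ , e)
      ≈⟨ coefficient-concatMap (allSizesDecSetoid l) (λ u → 𝐆 R l (Perm.id , u)) words _ ⟩
    ∑ words (λ u → ⟦ (n , Perm.id , u) ≟ (m , ρ , e) ⟧ + 0#)
      ≈⟨ ∑-zero words (λ u → trans (+-identityʳ _) (indicator-≢size n≢m (Perm.id , u) (ρ , e))) ⟩
    0#
      ≈⟨ sym (coefficient-inclusion-≢ n≢m (blockSum (contentBlock {n} 𝐧)) (ρ , e)) ⟩
    coefₛ (ι (contentBlock {n} 𝐧)) (m , ρ , e) ∎
    where
    words : List (Vec (Fin l) n)
    words = List.filter (hasContent? 𝐧) (allWords l n)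
  ... | yes ≡.refl = begin
    coefₛ (S R l 𝐧) (n , ρ , e)
      ≈⟨ coefficient-concatMap (allSizesDecSetoid l) (λ u → 𝐆 R l (Perm.id , u)) words _ ⟩
    ∑ words (λ u → ⟦ (n , Perm.id , u) ≟ (n , ρ , e) ⟧ + 0#)
      ≈⟨ ∑-filter (hasContent? 𝐧) (allWords l n) _ ⟩
    ∑ (allWords l n) (λ u → ⟦ hasContent? 𝐧 u ⟧ * (⟦ (n , Perm.id , u) ≟ (n , ρ , e) ⟧ + 0#))
      ≈⟨ ∑-cong (allWords l n) (λ u → *-congˡ (trans (+-identityʳ _)
           (indicator-sameSize (Perm.id , u) (ρ , e)))) ⟩
    ∑ (allWords l n) (λ u → ⟦ hasContent? 𝐧 u ⟧ * ⟦ (Perm.id , u) CP.≟ (ρ , e) ⟧)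
      ≈⟨ ∑-single (wordDecSetoid l n) (allWords l n) (enumerates-allWords l n) e
           (λ { _ ≡.refl → *-congˡ (indicator-⇔
             (mk⇔ (λ (id≈ρ , _) → Equivalence.to (id≈⇔increasing ρ) id≈ρ)
                  (λ inc → Equivalence.from (id≈⇔increasing ρ) inc , ≡.refl))
             ((Perm.id , e) CP.≟ (ρ , e)) (increasingOnBlocks? allZero (ρ ⟨$⟩ʳ_))) })
           (λ u u≢e → trans (*-congˡ (indicator-no ((Perm.id , u) CP.≟ (ρ , e)) (u≢e ∘ proj₂)))
             (zeroʳ _)) ⟩
    ⟦ hasContent? 𝐧 e ⟧ * ⟦ increasingOnBlocks? allZero (ρ ⟨$⟩ʳ_) ⟧
      ≈⟨ *-comm _ _ ⟩
    blockCoefficient (contentBlock 𝐧) (ρ , e)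
      ≈⟨ sym (coefficient-ι (contentBlock 𝐧) (ρ , e)) ⟩
    coefₛ (ι (contentBlock {n} 𝐧)) (n , ρ , e) ∎
    where
    words : List (Vec (Fin l) n)
    words = List.filter (hasContent? 𝐧) (allWords l n)

  scaleBlock : K → Block n → Block n
  scaleBlock r A = record
    { label     = label A
    ; monotone  = Block.monotone A
    ; weight    = λ u → r * weight A u
    ; symmetric = λ {u} {v} same → *-congˡ (Block.symmetric A {u} {v} same)
    }

  ι-scale : ∀ r (A : Block n) k → r * coefₛ (ι A) k ≈ coefₛ (ι (scaleBlock r A)) k
  ι-scale {n} r A (m , h) with n ℕ.≟ m
  ... | yes ≡.refl = trans (*-congˡ (coefficient-ι A h))
    (trans (*-swap r _ _) (sym (coefficient-ι (scaleBlock r A) h)))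
  ... | no n≢m = trans (*-congˡ (coefficient-inclusion-≢ n≢m (blockSum A) h))
    (trans (zeroʳ r) (sym (coefficient-inclusion-≢ n≢m (blockSum (scaleBlock r A)) h)))

  emptyBlock : K → Block 0
  emptyBlock r = record
    { blocks = 0 ; label = λ () ; monotone = λ () ; weight = λ _ → r ; symmetric = λ _ → refl }

  ι-empty : ∀ r k → r * coefₛ (𝐆 R l (Perm.id {0} , [])) k ≈ coefₛ (ι (emptyBlock r)) k
  ι-empty r (suc m , h) = trans
    (*-congˡ (trans (+-identityʳ _) (indicator-≢size (λ ()) (Perm.id , []) h)))
    (trans (zeroʳ r) (sym (coefficient-inclusion-≢ (λ ()) (blockSum (emptyBlock r)) h)))
  ι-empty r (zero , ρ , []) = trans
    (*-congˡ (trans (+-identityʳ _) (indicator-yes ((0 , Perm.id , []) ≟ (0 , ρ , []))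
      (sameSize ((λ ()) , ≡.refl)))))
    (trans (*-comm r 1#)
      (trans (*-congʳ (sym (indicator-yes (increasingOnBlocks? (label (emptyBlock r)) (ρ ⟨$⟩ʳ_)) λ ())))
             (sym (coefficient-ι (emptyBlock r) (ρ , [])))))

  ιₛ : ∃ Block → RawAlgebra.Carrier (FQSym R l)
  ιₛ (_ , A) = ι A

  BlockCombination : RawAlgebra.Carrier (FQSym R l) → Set _
  BlockCombination x = ∃ λ As → ∀ k → coefₛ x k ≈ ∑ As (λ A → coefₛ (ιₛ A) k)

  ι-combination : ∀ x (A : Block n) → x ≋ₛ ι A → BlockCombination x
  ι-combination x A x≋A = List.[ _ , A ] , λ k → trans (x≋A k) (sym (+-identityʳ _))

  ++-combination : ∀ {x y} → BlockCombination x → BlockCombination y → BlockCombination (x ++ y)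
  ++-combination {x} {y} (As , x≋) (Bs , y≋) = As ++ Bs , λ k →
    trans (coefficient-++ (allSizesDecSetoid l) x y k)
      (trans (+-cong (x≋ k) (y≋ k)) (sym (∑-++ As Bs _)))

  sym⇒combination : ∀ {x} → Sym R l x → BlockCombination x
  sym⇒combination (generator 𝐧) = ι-combination (S R l 𝐧) (contentBlock {Vec.sum 𝐧} 𝐧) (ι-content 𝐧 ≡.refl)
  sym⇒combination (respects {x} {y} x≈y gen) =
    let As , x≋ = sym⇒combination gen in As , λ k → trans (sym (x≈y k)) (x≋ k)
  sym⇒combination zeroᵍ = [] , λ _ → refl
  sym⇒combination (addᵍ {x} {y} genx geny) =
    ++-combination {x} {y} (sym⇒combination genx) (sym⇒combination geny)
  sym⇒combination (scaleᵍ r {x} gen) =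
    let As , x≋ = sym⇒combination gen
    in List.map (λ (n , A) → n , scaleBlock r A) As , λ k → begin
      coefₛ (List.map (map₁ (r *_)) x) k
        ≈⟨ coefficient-scale (allSizesDecSetoid l) r x k ⟩
      r * coefₛ x k
        ≈⟨ *-congˡ (x≋ k) ⟩
      r * ∑ As (λ A → coefₛ (ιₛ A) k)
        ≈⟨ sym (∑-distribˡ r As _) ⟩
      ∑ As (λ A → r * coefₛ (ιₛ A) k)
        ≈⟨ ∑-cong As (λ (n , A) → ι-scale r A k) ⟩
      ∑ As (λ (n , A) → coefₛ (ι (scaleBlock r A)) k)
        ≈⟨ sym (∑-map (λ (n , A) → n , scaleBlock r A) As _) ⟩
      ∑ (List.map (λ (n , A) → n , scaleBlock r A) As) (λ A → coefₛ (ιₛ A) k) ∎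
  sym⇒combination oneᵍ = ι-combination (𝐆 R l (Perm.id , [])) (emptyBlock 1#) λ k →
    trans (sym (*-identityˡ _)) (ι-empty 1# k)
  sym⇒combination (mulᵍ {x} {y} genx geny) =
    let As , x≋ = sym⇒combination genx
        Bs , y≋ = sym⇒combination geny
        Cs , xy≋ = bilinear-closed (allSizesDecSetoid l) mul {P = BlockCombination}
          (λ x≋y (As , x≋) → As , λ k → trans (sym (x≋y k)) (x≋ k))
          ([] , λ _ → refl)
          (λ {x} {y} → ++-combination {x} {y})
          ιₛ (λ (_ , A) (_ , B) → ι-combination (ι A ⋆ ι B) (juxtapose A B) (ι-juxtapose A B)) As Bs
    in Cs , λ k → trans
      (⋆-cong {x} {concatMap ιₛ As} {y} {concatMap ιₛ Bs}
        (λ k → trans (x≋ k) (sym (coefficient-concatMap (allSizesDecSetoid l) ιₛ As k)))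
        (λ k → trans (y≋ k) (sym (coefficient-concatMap (allSizesDecSetoid l) ιₛ Bs k))) k)
      (xy≋ k)

  atSize : Block m → Dec (m ≡ n) → List (Block n)
  atSize A (yes ≡.refl) = List.[ A ]
  atSize A (no _)       = []

  ∑-atSize : (A : Block m) (d : Dec (m ≡ n)) → ∀ h →
    coefₛ (ι A) (n , h) ≈ ∑ (atSize A d) (λ B → blockCoefficient B h)
  ∑-atSize A (yes ≡.refl) h = trans (coefficient-ι A h) (sym (+-identityʳ _))
  ∑-atSize A (no m≢n)     h = coefficient-inclusion-≢ m≢n (blockSum A) h

  -- A derivation of membership in `Sym` may pass through inhomogeneous elements even when it ends
  -- in degree n. So blocks of all sizes are collected first, and those of other sizes are dropped:
  -- they have no coefficient at colored permutations of size n.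
  symₙ⇒combination : ∀ {x} → Symₙ R l n x → ∃ λ (As : List (Block n)) →
                     ∀ h → coef x h ≈ coef (concatMap blockSum As) h
  symₙ⇒combination {n} {x} gen =
    let As , x≋ = sym⇒combination gen
        As′ = concatMap (λ (m , A) → atSize A (m ℕ.≟ n)) As
    in As′ , λ h → begin
      coef x h
        ≈⟨ sym (coefficient-inclusion x h) ⟩
      coefₛ (inclusion R l n x) (n , h)
        ≈⟨ x≋ (n , h) ⟩
      ∑ As (λ A → coefₛ (ιₛ A) (n , h))
        ≈⟨ ∑-cong As (λ (m , A) → ∑-atSize A (m ℕ.≟ n) h) ⟩
      ∑ As (λ (m , A) → ∑ (atSize A (m ℕ.≟ n)) (λ B → blockCoefficient B h))
        ≈⟨ sym (∑-concatMap (λ (m , A) → atSize A (m ℕ.≟ n)) As _) ⟩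
      ∑ As′ (λ B → blockCoefficient B h)
        ≈⟨ ∑-cong As′ (λ B → sym (coefficient-blockSum B h)) ⟩
      ∑ As′ (λ B → coef (blockSum B) h)
        ≈⟨ sym (coefficient-concatMap (coloredDecSetoid l n) blockSum As′ h) ⟩
      coef (concatMap blockSum As′) h ∎

  sym-concatMap : (f : A → RawAlgebra.Carrier (FQSym R l)) → (∀ x → Sym R l (f x)) →
                  ∀ xs → Sym R l (concatMap f xs)
  sym-concatMap f gen []       = zeroᵍ
  sym-concatMap f gen (x ∷ xs) = addᵍ (gen x) (sym-concatMap f gen xs)

  -- F with its first `i` letters filled in by the chosen representative of the content `𝐧`. As F is
  -- symmetric on the first block, the representative stands for every word of that content.
  restWeight : (𝐧 : Vec ℕ l) → (Vec (Fin l) (i ℕ.+ j) → K) →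
    Dec (∃ λ (r : Vec (Fin l) i) → HasContent 𝐧 r) → Vec (Fin l) j → K
  restWeight 𝐧 F (yes (r , _)) v = F (r Vec.++ v)
  -- An arbitrary default: without a word of content `𝐧` the factor from `contentBlock 𝐧` is zero.
  restWeight 𝐧 F (no _)        v = 0#

  -- The weight of a block sum depends on the first block only through its
  -- content, so the sum splits into products S 𝐧 ⋆ ι B over all contents 𝐧.
  module FirstBlock {k : ℕ} (label′ : Fin j → Fin k) (mono : Monotone label′)
    (F : Vec (Fin l) (i ℕ.+ j) → K)
    (F-symmetric : ∀ {u v} → SameContent (allZero {i} ⊔ˡ label′) u v → F u ≈ F v) where

    rest : Vec ℕ l → Block j
    rest 𝐧 = record
      { label     = label′
      ; monotone  = mono
      ; weight    = restWeight 𝐧 F (someWord? i 𝐧)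
      ; symmetric = λ {u} {v} → restWeight-symmetric (someWord? i 𝐧) {u} {v}
      }
      where
      restWeight-symmetric : (d : Dec (∃ λ (r : Vec (Fin l) i) → HasContent 𝐧 r)) →
        ∀ {u v} → SameContent label′ u v → restWeight 𝐧 F d u ≈ restWeight 𝐧 F d v
      restWeight-symmetric (yes (r , _)) {u} {v} same = F-symmetric {r Vec.++ u} {r Vec.++ v}
        (Equivalence.from (sameContent-⊔ˡ allZero label′ {r} {r} {u} {v}) ((λ _ → ≡.refl) , same))
      restWeight-symmetric (no _) _ = refl

    piece : Vec ℕ l → Block (i ℕ.+ j)
    piece 𝐧 = juxtapose (contentBlock {i} 𝐧) (rest 𝐧)

    piece-sym : (∀ 𝐧 → Sym R l (ι (rest 𝐧))) → ∀ 𝐧 → Sym R l (ι (piece 𝐧))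
    piece-sym rest-sym 𝐧 with Vec.sum 𝐧 ℕ.≟ i
    ... | yes size = respects
      (λ k → trans (⋆-cong {S R l 𝐧} {ι (contentBlock {i} 𝐧)} {ι (rest 𝐧)} {ι (rest 𝐧)}
                      (ι-content 𝐧 size) (λ _ → refl) k)
                   (ι-juxtapose (contentBlock {i} 𝐧) (rest 𝐧) k))
      (mulᵍ (generator 𝐧) (rest-sym 𝐧))
    -- No word of length `i` has a content with another total, so this piece is zero.
    ... | no size≢ = respects {x = inclusion R l (i ℕ.+ j) []}
      (inclusion-cong {x = []} {blockSum (piece 𝐧)} λ h → sym (trans (coefficient-blockSum (piece 𝐧) h)
        (trans (*-congˡ (indicator-*-no (hasContent? 𝐧 (Vec.take i (proj₂ h)))
          λ content → size≢ (hasContent-sum {𝐧 = 𝐧} (Vec.take i (proj₂ h)) content))) (zeroʳ _)))) zeroᵍ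

    restWeight-content : (𝐧 : Vec ℕ l) (u : Vec (Fin l) i) (v : Vec (Fin l) j) → HasContent 𝐧 u →
      (d : Dec (∃ λ (r : Vec (Fin l) i) → HasContent 𝐧 r)) → restWeight 𝐧 F d v ≈ F (u Vec.++ v)
    restWeight-content 𝐧 u v content (yes (r , content-r)) = F-symmetric {r Vec.++ v} {u Vec.++ v}
      (Equivalence.from (sameContent-⊔ˡ allZero label′ {r} {u} {v} {v})
        (sameContent-hasContent {𝐧 = 𝐧} {r} {u} content-r content , λ _ → ≡.refl))
    restWeight-content 𝐧 u v content (no ∄) = contradiction (u , content) ∄

    contents : List (Vec (Fin (suc i)) l)
    contents = allWords (suc i) l

    -- With e = u ++ v, only the content of `u` contributes. Its term is F (r ++ v) for the
    -- representative r, and this equals F (u ++ v) because r and `u` have the same content.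
    ∑-pieces : ∀ e → ∑ contents (λ N → weight (piece (Vec.map Fin.toℕ N)) e) ≈ F e
    ∑-pieces e with Vec.splitAt i e
    ... | u , v , ≡.refl = ∑-single (wordDecSetoid (suc i) l) contents
      (enumerates-allWords (suc i) l) (boundedContent u)
      (λ N N≡ → let content = Equivalence.from (hasContent⇔bounded N u) N≡ in
        trans (indicator-*-yes (hasContent? (Vec.map Fin.toℕ N) u) content)
              (restWeight-content (Vec.map Fin.toℕ N) u v content (someWord? i (Vec.map Fin.toℕ N))))
      (λ N N≢ → indicator-*-no (hasContent? (Vec.map Fin.toℕ N) u)
        (N≢ ∘ Equivalence.to (hasContent⇔bounded N u)))

  ι-cong : (A B : Block n) → (∀ h → blockCoefficient A h ≈ blockCoefficient B h) → ι A ≋ₛ ι B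
  ι-cong A B A≈B = inclusion-cong {x = blockSum A} {blockSum B} λ h →
    trans (coefficient-blockSum A h) (trans (A≈B h) (sym (coefficient-blockSum B h)))

  -- The fields of `Block` appear as separate arguments so that the recursion can run on the number
  -- k of labels. With no labels the size is 0 and the block sum is the multiple F [] of the unit.
  block-sym : ∀ k (label : Fin n → Fin k) (mono : Monotone label) (F : Vec (Fin l) n → K)
    (F-symmetric : ∀ {u v} → SameContent label u v → F u ≈ F v) →
    Sym R l (ι (record { label = label ; monotone = mono ; weight = F
                       ; symmetric = λ {u} {v} → F-symmetric {u} {v} }))
  block-sym {zero} zero label mono F F-symmetric = respects
    (λ k → trans (coefficient-scale (allSizesDecSetoid l) (F []) (𝐆 R l (Perm.id {0} , [])) k)
      (trans (ι-empty (F []) k) (ι-cong (emptyBlock (F [])) whole agree k)))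
    (scaleᵍ (F []) oneᵍ)
    where
    whole : Block 0
    whole = record { label = label ; monotone = mono ; weight = F
                   ; symmetric = λ {u} {v} → F-symmetric {u} {v} }
    agree : ∀ h → blockCoefficient (emptyBlock (F [])) h ≈ blockCoefficient whole h
    agree (ρ , []) = *-congʳ (indicator-⇔ (mk⇔ (λ _ ()) (λ _ ()))
      (increasingOnBlocks? (Block.label (emptyBlock (F []))) (ρ ⟨$⟩ʳ_))
      (increasingOnBlocks? label (ρ ⟨$⟩ʳ_)))
  block-sym {suc n} zero label mono F F-symmetric = contradiction (label zero) Fin.¬Fin0
  block-sym {n} (suc k) label mono F F-symmetric with splitZeroBlock label mono
  ... | i , j , ≡.refl , label′ , mono′ , label≗ = respects pieces≋
    (sym-concatMap (λ N → ι (piece (Vec.map Fin.toℕ N)))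
      (λ N → piece-sym
        (λ 𝐧 → block-sym k label′ mono′ (restWeight 𝐧 F (someWord? i 𝐧)) 
          (λ {u} {v} → Block.symmetric (rest 𝐧) {u} {v}))
        (Vec.map Fin.toℕ N))
      contents)
    where
    open FirstBlock {j} {i} label′ mono′ F (λ {u} {v} same → F-symmetric {u} {v} λ z →
      ≡.trans (Pairs.occurrences-cong (λ x → ≡.cong (_, lookup u x) (label≗ x)) z)
        (≡.trans (same z)
          (Pairs.occurrences-cong (λ x → ≡.cong (_, lookup v x) (≡.sym (label≗ x))) z)))
    whole : Block (i ℕ.+ j)
    whole = record { label = label ; monotone = mono ; weight = F
                   ; symmetric = λ {u} {v} → F-symmetric {u} {v} }
    pieces≋ : concatMap (λ N → ι (piece (Vec.map Fin.toℕ N))) contents ≋ₛ ι whole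
    pieces≋ (m , h) with i ℕ.+ j ℕ.≟ m
    ... | no i+j≢m = trans
      (coefficient-concatMap (allSizesDecSetoid l) (λ N → ι (piece (Vec.map Fin.toℕ N))) contents (m , h))
      (trans (∑-zero contents λ N →
        coefficient-inclusion-≢ i+j≢m (blockSum (piece (Vec.map Fin.toℕ N))) h)
        (sym (coefficient-inclusion-≢ i+j≢m (blockSum whole) h)))
    pieces≋ (_ , h@(ρ , e)) | yes ≡.refl = begin
      coefₛ (concatMap (λ N → ι (piece (Vec.map Fin.toℕ N))) contents) (i ℕ.+ j , h)
        ≈⟨ coefficient-concatMap (allSizesDecSetoid l) (λ N → ι (piece (Vec.map Fin.toℕ N))) contents _ ⟩
      ∑ contents (λ N → coefₛ (ι (piece (Vec.map Fin.toℕ N))) (i ℕ.+ j , h))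
        ≈⟨ ∑-cong contents (λ N → coefficient-ι (piece (Vec.map Fin.toℕ N)) h) ⟩
      ∑ contents (λ N → ⟦ increasingOnBlocks? (allZero {i} ⊔ˡ label′) (ρ ⟨$⟩ʳ_) ⟧
                        * weight (piece (Vec.map Fin.toℕ N)) e)
        ≈⟨ ∑-distribˡ _ contents _ ⟩
      ⟦ increasingOnBlocks? (allZero {i} ⊔ˡ label′) (ρ ⟨$⟩ʳ_) ⟧
        * ∑ contents (λ N → weight (piece (Vec.map Fin.toℕ N)) e)
        ≈⟨ *-cong (indicator-⇔
             (mk⇔ (increasing-cong (λ x → ≡.sym (label≗ x)) (λ _ → ≡.refl))
                  (increasing-cong label≗ (λ _ → ≡.refl)))
             (increasingOnBlocks? (allZero {i} ⊔ˡ label′) (ρ ⟨$⟩ʳ_))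
             (increasingOnBlocks? label (ρ ⟨$⟩ʳ_))) (∑-pieces e) ⟩
      blockCoefficient whole h
        ≈⟨ sym (coefficient-ι whole h) ⟩
      coefₛ (ι whole) (i ℕ.+ j , h) ∎

-- Products in the group algebra

module Wreath (R : CommutativeRing c ℓ) {l : ℕ} {_∙_ : Op₂ (Fin l)} {ε : Fin l} {_⁻¹ : Op₁ (Fin l)}
              (C : IsGroup _≡_ _∙_ ε _⁻¹) (n : ℕ) where
  open CommutativeRing R renaming (Carrier to K) hiding (zero)
  open Sums R
  open Blocks R l
  open Span R l
  open Block using (label; weight; blockSum; blockCoefficient; coefficient-blockSum)
  open import Algebra.Properties.CommutativeSemigroup *-commutativeSemigroup
    using () renaming (interchange to *-interchange)
  open import Relation.Binary.Reasoning.Setoid setoid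
  private
    module C = IsGroup C
    colorGroup : Group 0ℓ 0ℓ
    colorGroup = record { isGroup = C }
    module CG = GroupProperties colorGroup

    infixl 7 _·_
    _·_ : Op₂ (ColoredPermutation l n)
    _·_ = _≀∙_ C n

    infix 4 _≋ₙ_
    _≋ₙ_ : FQSymₙ R l n → FQSymₙ R l n → Set _
    _≋ₙ_ = _≋_ (coloredDecSetoid l n)

  infixl 7 _⊙_
  _⊙_ : Op₂ (FQSymₙ R l n)
  _⊙_ = RawAlgebra._*_ (wreathAlgebra R C n)

  -- The color word d for which (σ, c) · (τ, d) has color word e, whatever σ is.
  quotient : Vec (Fin l) n → Permutation′ n → Vec (Fin l) n → Vec (Fin l) n
  quotient c τ e = tabulate λ x → (lookup c (τ ⟨$⟩ʳ x) ⁻¹) ∙ lookup e x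

  -- Left cancellation in the wreath product: once the left factor is fixed, the double sum in a
  -- product has one term left, with permutation σ⁻¹ρ.
  ·-solve : ∀ σ c ρ e {g} →
    ((σ , c) · g CP.≈ (ρ , e)) ⇔ (g CP.≈ (ρ ∘ₚ Perm.flip σ , quotient c (ρ ∘ₚ Perm.flip σ) e))
  ·-solve σ c ρ e {τ , d} = mk⇔
    (λ (στ≈ρ , cd≡e) →
      let τ≈ = λ x → ≡.trans (≡.sym (inverseˡ σ)) (≡.cong (σ ⟨$⟩ˡ_) (στ≈ρ x))
      in τ≈ , ≡.trans (≡.sym (Vec.tabulate∘lookup d)) (Vec.tabulate-cong λ x →
        ≡.trans (≡.sym (CG.\\-leftDividesʳ (lookup c (τ ⟨$⟩ʳ x)) (lookup d x)))
          (≡.trans (≡.cong ((lookup c (τ ⟨$⟩ʳ x) ⁻¹) ∙_)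
                     (≡.trans (≡.sym (Vec.lookup∘tabulate _ x)) (≡.cong (λ w → lookup w x) cd≡e)))
                (≡.cong (λ y → (lookup c y ⁻¹) ∙ lookup e x) (τ≈ x)))))
    (λ (τ≈ , d≡) →
      (λ x → ≡.trans (≡.cong (σ ⟨$⟩ʳ_) (τ≈ x)) (inverseʳ σ)) ,
      ≡.trans (Vec.tabulate-cong λ x →
        ≡.trans (≡.cong₂ (λ y z → lookup c y ∙ z) (τ≈ x)
                  (≡.trans (≡.cong (λ w → lookup w x) d≡) (Vec.lookup∘tabulate _ x)))
                (CG.\\-leftDividesˡ _ _))
        (Vec.tabulate∘lookup e))

  ⊙-cong : ∀ {x x′ y y′} → x ≋ₙ x′ → y ≋ₙ y′ → x ⊙ y ≋ₙ x′ ⊙ y′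
  ⊙-cong {x} {x′} {y} {y′} = bilinear-cong (coloredDecSetoid l n) (λ g h → basis R (g · h))
    (λ {g} {g′} {h} {h′} g≈ h≈ k → +-congʳ (indicator-respects (coloredDecSetoid l n) k
      {g · h} {g′ · h′} (Group.∙-cong (wreathGroup C n) {g} {g′} {h} {h′} g≈ h≈)))
    {x} {x′} {y} {y′}

  module _ (A B : Block n) where

    -- The sum over the color words c of σ in the product of A and B at (ρ , e),
    -- where τ = σ⁻¹ρ.
    colorSum : Permutation′ n → Vec (Fin l) n → K
    colorSum τ e = ∑ (allWords l n) λ c → weight A c * weight B (quotient c τ e)

    summand : Permutation′ n → Vec (Fin l) n → Permutation′ n → K
    summand ρ e σ = (⟦ increasingOnBlocks? (label A) (σ ⟨$⟩ʳ_) ⟧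
          * ⟦ increasingOnBlocks? (label B) ((ρ ∘ₚ Perm.flip σ) ⟨$⟩ʳ_) ⟧)
        * colorSum (ρ ∘ₚ Perm.flip σ) e

    coefficient-⊙ : ∀ ρ e →
      coef (blockSum A ⊙ blockSum B) (ρ , e) ≈ ∑ (allPermutations n) (summand ρ e)
    coefficient-⊙ ρ e = begin
      coef (blockSum A ⊙ blockSum B) (ρ , e)
        ≈⟨ coefficient-bilinear (coloredDecSetoid l n) (λ g h → basis R (g · h))
             (blockSum A) (blockSum B) (ρ , e) ⟩
      evaluate (λ g → evaluate (λ h → ⟦ g · h CP.≟ (ρ , e) ⟧ + 0#) (blockSum B)) (blockSum A)
        ≈⟨ ∑-map (λ g → blockCoefficient A g , g) colored
             (λ (r , g) → r * evaluate (λ h → ⟦ g · h CP.≟ (ρ , e) ⟧ + 0#) (blockSum B)) ⟩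
      ∑ colored (λ g → blockCoefficient A g
        * evaluate (λ h → ⟦ g · h CP.≟ (ρ , e) ⟧ + 0#) (blockSum B))
        ≈⟨ ∑-cong colored (λ g → *-congˡ (inner g)) ⟩
      ∑ colored (λ (σ , c) → blockCoefficient A (σ , c)
        * blockCoefficient B (ρ ∘ₚ Perm.flip σ , quotient c (ρ ∘ₚ Perm.flip σ) e))
        ≈⟨ ∑-cartesianProductWith _,_ (allPermutations n) (allWords l n) _ ⟩
      ∑ (allPermutations n) (λ σ → ∑ (allWords l n) (λ c → blockCoefficient A (σ , c)
        * blockCoefficient B (ρ ∘ₚ Perm.flip σ , quotient c (ρ ∘ₚ Perm.flip σ) e)))
        ≈⟨ ∑-cong (allPermutations n) (λ σ → trans
             (∑-cong (allWords l n) λ c → *-interchange _ _ _ _)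
             (∑-distribˡ _ (allWords l n) _)) ⟩
      ∑ (allPermutations n) (summand ρ e) ∎
      where
      colored : List (ColoredPermutation l n)
      colored = allColored l n
      inner : ∀ g → evaluate (λ h → ⟦ g · h CP.≟ (ρ , e) ⟧ + 0#) (blockSum B) ≈
        blockCoefficient B (ρ ∘ₚ Perm.flip (proj₁ g) , quotient (proj₂ g) (ρ ∘ₚ Perm.flip (proj₁ g)) e)
      inner g@(σ , c) = trans
        (∑-map (λ h → blockCoefficient B h , h) colored (λ (r , h) → r * (⟦ g · h CP.≟ (ρ , e) ⟧ + 0#)))
        (∑-single (coloredDecSetoid l n) colored (enumerates-allColored l n) g⁻¹ρe
          (λ h h≈ → trans
            (*-cong (Block.blockCoefficient-respects B {h} {g⁻¹ρe} h≈)
              (trans (+-identityʳ _) (indicator-yes (g · h CP.≟ (ρ , e))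
                (Equivalence.from (·-solve σ c ρ e {h}) h≈))))
            (*-identityʳ _))
          (λ h h≉ → trans (*-congˡ (trans (+-identityʳ _) (indicator-no (g · h CP.≟ (ρ , e))
            (h≉ ∘ Equivalence.to (·-solve σ c ρ e {h}))))) (zeroʳ _)))
        where
        g⁻¹ρe : ColoredPermutation l n
        g⁻¹ρe = ρ ∘ₚ Perm.flip σ , quotient c (ρ ∘ₚ Perm.flip σ) e

    -- τ′ = πτ with π preserving the blocks of A: substitute c ∘ π for c.
    colorSum-cong : ∀ τ τ′ → (∀ x → label A (τ ⟨$⟩ʳ x) ≡ label A (τ′ ⟨$⟩ʳ x)) →
                    ∀ e → colorSum τ e ≈ colorSum τ′ e
    colorSum-cong τ τ′ same e = sym (begin
      ∑ (allWords l n) (λ c → weight A c * weight B (quotient c τ′ e))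
        ≈⟨ ∑-cong (allWords l n) (λ c → *-cong
             (sym (Block.symmetric A {permute c} {c} (sameContent-rearranged (label A) π πfixes c)))
             (reflexive (≡.cong (weight B) (quotient-permute c)))) ⟩
      ∑ (allWords l n) (λ c → weight A (permute c) * weight B (quotient (permute c) τ e))
        ≈⟨ ∑-reindex (wordDecSetoid l n) (allWords l n) (enumerates-allWords l n)
             permute unpermute (mk⇔ (λ { ≡.refl → unpermute-permute _ }) (λ { ≡.refl → permute-unpermute _ }))
             {λ c → weight A c * weight B (quotient c τ e)} (λ { ≡.refl → refl }) ⟩
      ∑ (allWords l n) (λ c → weight A c * weight B (quotient c τ e)) ∎)
      where
      π : Permutation′ n
      π = Perm.flip τ ∘ₚ τ′
      permute unpermute : Vec (Fin l) n → Vec (Fin l) n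
      permute   = rearranged (π ⟨$⟩ʳ_)
      unpermute = rearranged (π ⟨$⟩ˡ_)
      πfixes : ∀ x → label A (π ⟨$⟩ʳ x) ≡ label A x
      πfixes x = ≡.trans (≡.sym (same _)) (≡.cong (label A) (inverseʳ τ))
      quotient-permute : ∀ c → quotient c τ′ e ≡ quotient (permute c) τ e
      quotient-permute c = Vec.tabulate-cong λ x → ≡.cong (λ y → (y ⁻¹) ∙ lookup e x)
        (≡.sym (≡.trans (Vec.lookup∘tabulate _ (τ ⟨$⟩ʳ x))
          (≡.cong (λ y → lookup c (τ′ ⟨$⟩ʳ y)) (inverseˡ τ))))
      permute-unpermute : ∀ c → c ≡ permute (unpermute c)
      permute-unpermute c = ≡.sym (≡.trans
        (Vec.tabulate-cong λ x → ≡.trans (Vec.lookup∘tabulate _ (π ⟨$⟩ʳ x)) (≡.cong (lookup c) (inverseˡ π)))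
        (Vec.tabulate∘lookup c))
      unpermute-permute : ∀ c → c ≡ unpermute (permute c)
      unpermute-permute c = ≡.sym (≡.trans
        (Vec.tabulate-cong λ x → ≡.trans (Vec.lookup∘tabulate _ (π ⟨$⟩ˡ x)) (≡.cong (lookup c) (inverseʳ π)))
        (Vec.tabulate∘lookup c))

    -- The quotient of the rearranged word by c along τ is the rearrangement by π of the quotient of
    -- e by c along τπ⁻¹, and the weight of `B` does not see π.
    colorSum-rearranged : ∀ τ π → (∀ x → label B (π ⟨$⟩ʳ x) ≡ label B x) → ∀ e →
      colorSum τ (rearranged (π ⟨$⟩ʳ_) e) ≈ colorSum (Perm.flip π ∘ₚ τ) e
    colorSum-rearranged τ π πfixes e = ∑-cong (allWords l n) λ c → *-congˡ (trans
      (reflexive (≡.cong (weight B) (Vec.tabulate-cong λ x → ≡.trans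
        (≡.cong₂ (λ y z → (lookup c (τ ⟨$⟩ʳ y) ⁻¹) ∙ z) (≡.sym (inverseˡ π)) (Vec.lookup∘tabulate _ x))
        (≡.sym (Vec.lookup∘tabulate _ (π ⟨$⟩ʳ x))))))
      (Block.symmetric B (sameContent-rearranged (label B) π πfixes
        (quotient c (Perm.flip π ∘ₚ τ) e))))

    module _ (α : Vec (Fin (Block.blocks A)) n) where
      open Letters {Block.blocks A} using (occurrences; matching; occurrences-permute; occurrences-cong)

      refined : Fin n → Fin (Block.blocks B ℕ.* Block.blocks A)
      refined x = Fin.combine (label B x) (lookup α x)

      -- Equality of contents is what α = a ∘ τ needs in order to have a solution τ; `matched` is
      -- one such solution.
      Matches : Set
      Matches = ∀ y → occurrences (lookup α) y ≡ occurrences (label A) y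

      matches? : Dec Matches
      matches? = Fin.all? λ y → occurrences (lookup α) y ℕ.≟ occurrences (label A) y

      matched : Matches → Permutation′ n
      matched m = proj₁ (matching (lookup α) (label A) m)

      label-matched : ∀ m x → label A (matched m ⟨$⟩ʳ x) ≡ lookup α x
      label-matched m = proj₁ (proj₂ (matching (lookup α) (label A) m))

      -- By `colorSum-cong` every solution τ of a ∘ τ = α gives the same sum, so `matched` is as
      -- good as σ⁻¹ρ and the weight does not involve ρ. Without a solution α contributes nothing.
      refinedWeight : Dec Matches → Vec (Fin l) n → K
      refinedWeight (yes m) e = colorSum (matched m) e
      refinedWeight (no _)  e = 0#

      -- A permutation π preserving the blocks of `refined` preserves both `label B` and α. The
      -- first property moves π from the color word to τ, replacing τ by τπ⁻¹; by the second, a ∘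
      -- τπ⁻¹ is still α, so the color sum is unchanged.
      refinedWeight-symmetric : ∀ d {u v} → SameContent refined u v →
                                refinedWeight d u ≈ refinedWeight d v
      refinedWeight-symmetric (no _) _ = refl
      refinedWeight-symmetric (yes m) {u} {v} same with sameContent⇒rearranged refined {u} {v} same
      ... | π , πfixes , ≡.refl = trans
        (colorSum-rearranged (matched m) π
          (λ x → Fin.combine-injectiveˡ _ _ _ (lookup α x) (πfixes x)) v)
        (colorSum-cong (Perm.flip π ∘ₚ matched m) (matched m) (λ x →
          ≡.trans (label-matched m _) (≡.trans
            (≡.sym (Fin.combine-injectiveʳ (label B (π ⟨$⟩ʳ (π ⟨$⟩ˡ x))) _ _ _ (πfixes (π ⟨$⟩ˡ x))))
            (≡.trans (≡.cong (lookup α) (inverseʳ π)) (≡.sym (label-matched m x))))) v)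

      refinedBlock : Dec (Monotone refined) → List (Block n)
      refinedBlock (no _)     = []
      refinedBlock (yes mono) = List.[ record
        { label     = refined
        ; monotone  = mono
        ; weight    = refinedWeight matches?
        ; symmetric = λ {u} {v} → refinedWeight-symmetric matches? {u} {v}
        } ]

      ∑-refinedBlock : ∀ d ρ e → ∑ (refinedBlock d) (λ D → blockCoefficient D (ρ , e)) ≈
        (⟦ d ⟧ * ⟦ increasingOnBlocks? refined (ρ ⟨$⟩ʳ_) ⟧) * refinedWeight matches? e
      ∑-refinedBlock (no _) ρ e = sym (trans (*-congʳ (zeroˡ _)) (zeroˡ _))
      ∑-refinedBlock (yes mono) ρ e = trans (+-identityʳ _) (*-congʳ (sym (*-identityˡ _)))

      blocksOf : Permutation′ n → Permutation′ n → Vec (Fin (Block.blocks A)) n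
      blocksOf ρ σ = rearranged ((ρ ∘ₚ Perm.flip σ) ⟨$⟩ʳ_) (tabulate (label A))

      lookup-blocksOf : ∀ ρ σ x → lookup (blocksOf ρ σ) x ≡ label A (σ ⟨$⟩ˡ (ρ ⟨$⟩ʳ x))
      lookup-blocksOf ρ σ x = ≡.trans (Vec.lookup∘tabulate _ x) (Vec.lookup∘tabulate (label A) _)

      -- Exactly one σ that increases on the blocks of A makes α the word of
      -- blocks of σ⁻¹ρ, provided that α has the content of label A.
      ∑-fibre : ∀ ρ e (d : Dec Matches) → ∑ (allPermutations n) (λ σ →
          ⟦ Vec.≡-dec Fin._≟_ α (blocksOf ρ σ) ⟧ * summand ρ e σ) ≈
        (⟦ monotone? refined ⟧ * ⟦ increasingOnBlocks? refined (ρ ⟨$⟩ʳ_) ⟧) * refinedWeight d e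
      -- The word a ∘ σ⁻¹ρ is a rearrangement of `label A`, so it cannot equal an α of another
      -- content.
      ∑-fibre ρ e (no ¬m) = trans
        (∑-zero (allPermutations n) λ σ → indicator-*-no (Vec.≡-dec Fin._≟_ α (blocksOf ρ σ))
          λ α≡ → ¬m λ y → ≡.trans
            (occurrences-cong (λ x → ≡.trans (≡.cong (λ w → lookup w x) α≡) (lookup-blocksOf ρ σ x)) y)
            (occurrences-permute (label A) (ρ ∘ₚ Perm.flip σ) y))
        (sym (zeroʳ _))
      ∑-fibre ρ e (yes m) = ∑-single (permutationDecSetoid n) (allPermutations n)
        (enumerates-allPermutations n) σ₀
        (λ σ σ≈σ₀ →
          let τ = ρ ∘ₚ Perm.flip σ
              incσ = increasing-cong (λ _ → ≡.refl) (λ x → ≡.sym (σ≈σ₀ x)) incσ₀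
              τ-blocks = λ x → ≡.trans (≡.sym (σ₀-blocks (τ ⟨$⟩ʳ x)))
                (≡.trans (≡.cong (λ y → lookup α (ρ ⟨$⟩ˡ y))
                  (≡.trans (≡.sym (σ≈σ₀ _)) (inverseʳ σ))) (≡.cong (lookup α) (inverseˡ ρ)))
          in trans
            (indicator-*-yes (Vec.≡-dec Fin._≟_ α (blocksOf ρ σ))
              (≡.trans (≡.sym (Vec.tabulate∘lookup α)) (≡.trans
                (Vec.tabulate-cong λ x → ≡.sym (≡.trans (lookup-blocksOf ρ σ x) (τ-blocks x)))
                (Vec.tabulate∘lookup (blocksOf ρ σ)))))
            (*-cong
              (trans (indicator-*-yes (increasingOnBlocks? (label A) (σ ⟨$⟩ʳ_)) incσ)
                (trans (indicator-⇔ (factored σ incσ τ-blocks)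
                    (increasingOnBlocks? (label B) (τ ⟨$⟩ʳ_))
                    (monotone? refined ×-dec increasingOnBlocks? refined (ρ ⟨$⟩ʳ_)))
                  (indicator-× (monotone? refined) (increasingOnBlocks? refined (ρ ⟨$⟩ʳ_)))))
              (colorSum-cong τ (matched m)
                (λ x → ≡.trans (τ-blocks x) (≡.sym (label-matched m x))) e)))
        off
        where
        found : ∃ λ (σ : Permutation′ n) → (∀ x → lookup α (ρ ⟨$⟩ˡ (σ ⟨$⟩ʳ x)) ≡ label A x) ×
                  IncreasingOnBlocks (label A) (σ ⟨$⟩ʳ_)
        -- The condition a ∘ σ⁻¹ρ = α reads (α ∘ ρ⁻¹) ∘ σ = a. So σ₀ is a matching of `label A` with
        -- α ∘ ρ⁻¹, and the order property of `matching` makes it increase on the blocks of `A`.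
        found = matching (label A) (lookup α ∘ (ρ ⟨$⟩ˡ_)) λ y → ≡.trans (≡.sym (m y))
          (≡.sym (occurrences-permute (lookup α) (Perm.flip ρ) y))
        σ₀ : Permutation′ n
        σ₀ = proj₁ found
        σ₀-blocks : ∀ x → lookup α (ρ ⟨$⟩ˡ (σ₀ ⟨$⟩ʳ x)) ≡ label A x
        σ₀-blocks = proj₁ (proj₂ found)
        incσ₀ : IncreasingOnBlocks (label A) (σ₀ ⟨$⟩ʳ_)
        incσ₀ = proj₂ (proj₂ found)
        factored : ∀ σ → IncreasingOnBlocks (label A) (σ ⟨$⟩ʳ_) →
          (∀ x → label A (σ ⟨$⟩ˡ (ρ ⟨$⟩ʳ x)) ≡ lookup α x) →
          IncreasingOnBlocks (label B) ((ρ ∘ₚ Perm.flip σ) ⟨$⟩ʳ_) ⇔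
          (Monotone refined × IncreasingOnBlocks refined (ρ ⟨$⟩ʳ_))
        factored σ incσ τ-blocks = mk⇔
          (λ incτ → let mono , inc = Equivalence.to factors incτ in
            (λ x y x≤y → ≡.subst₂ Fin._≤_ (p≗ x) (p≗ y) (mono x y x≤y)) ,
            increasing-cong p≗ (λ _ → inverseʳ σ) inc)
          (λ (mono , inc) → Equivalence.from factors
            ((λ x y x≤y → ≡.subst₂ Fin._≤_ (≡.sym (p≗ x)) (≡.sym (p≗ y)) (mono x y x≤y)) ,
             increasing-cong (λ x → ≡.sym (p≗ x)) (λ _ → ≡.sym (inverseʳ σ)) inc))
          where
          factors = factor-increasing (label A) (label B) σ (ρ ∘ₚ Perm.flip σ)
            (Block.monotone A) (Block.monotone B) incσ
          p≗ : ∀ x → Fin.combine (label B x) (label A (σ ⟨$⟩ˡ (ρ ⟨$⟩ʳ x))) ≡ refined x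
          p≗ x = ≡.cong (Fin.combine (label B x)) (τ-blocks x)
        off : ∀ σ → ¬ σ Perm.≈ σ₀ → ⟦ Vec.≡-dec Fin._≟_ α (blocksOf ρ σ) ⟧ * summand ρ e σ ≈ 0#
        off σ σ≉σ₀ with Vec.≡-dec Fin._≟_ α (blocksOf ρ σ)
        ... | no _ = zeroˡ _
        -- Here σ and σ₀ send each block of `A` to the same letters; if σ also increased on the
        -- blocks, the two would coincide.
        ... | yes α≡ = trans (*-congˡ (trans (*-congʳ (indicator-*-no (increasingOnBlocks? (label A) (σ ⟨$⟩ʳ_))
          λ incσ → σ≉σ₀ (blockIncreasing-unique (label A) σ σ₀ (λ x →
            ≡.trans (≡.cong (λ y → label A (σ ⟨$⟩ˡ y)) (≡.sym (inverseʳ ρ)))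
              (≡.trans (≡.sym (lookup-blocksOf ρ σ (ρ ⟨$⟩ˡ x)))
                (≡.trans (≡.cong (λ w → lookup w (ρ ⟨$⟩ˡ x)) (≡.sym α≡))
                  (≡.trans (≡.cong (λ y → lookup α (ρ ⟨$⟩ˡ y)) (≡.sym (inverseʳ σ₀)))
                    (σ₀-blocks (σ₀ ⟨$⟩ˡ x)))))) incσ incσ₀)))
          (zeroˡ _))) (zeroʳ _)

    refinedBlocks : List (Block n)
    refinedBlocks = concatMap (λ α → refinedBlock α (monotone? (refined α))) (allWords (Block.blocks A) n)

    ⊙-refinedBlocks : blockSum A ⊙ blockSum B ≋ₙ concatMap blockSum refinedBlocks
    ⊙-refinedBlocks (ρ , e) = begin
      coef (blockSum A ⊙ blockSum B) (ρ , e)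
        ≈⟨ coefficient-⊙ ρ e ⟩
      ∑ perms (summand ρ e)
        -- Each σ is assigned to the one word α = a ∘ σ⁻¹ρ, so that the sum can be regrouped by α.
        ≈⟨ ∑-cong perms (λ σ → sym (∑-single (wordDecSetoid (Block.blocks A) n) words
             (enumerates-allWords (Block.blocks A) n) (blocksOf₀ σ)
             (λ α α≡ → indicator-*-yes (Vec.≡-dec Fin._≟_ α (blocksOf₀ σ)) α≡)
             (λ α α≢ → indicator-*-no (Vec.≡-dec Fin._≟_ α (blocksOf₀ σ)) α≢))) ⟩
      ∑ perms (λ σ → ∑ words (λ α → ⟦ Vec.≡-dec Fin._≟_ α (blocksOf₀ σ) ⟧ * summand ρ e σ))
        ≈⟨ ∑-comm perms words _ ⟩
      ∑ words (λ α → ∑ perms (λ σ → ⟦ Vec.≡-dec Fin._≟_ α (blocksOf₀ σ) ⟧ * summand ρ e σ))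
        ≈⟨ ∑-cong words (λ α → trans (∑-fibre α ρ e (matches? α))
             (sym (∑-refinedBlock α (monotone? (refined α)) ρ e))) ⟩
      ∑ words (λ α → ∑ (refinedBlock α (monotone? (refined α))) (λ D → blockCoefficient D (ρ , e)))
        ≈⟨ sym (∑-concatMap (λ α → refinedBlock α (monotone? (refined α))) words _) ⟩
      ∑ refinedBlocks (λ D → blockCoefficient D (ρ , e))
        ≈⟨ ∑-cong refinedBlocks (λ D → sym (coefficient-blockSum D (ρ , e))) ⟩
      ∑ refinedBlocks (λ D → coef (blockSum D) (ρ , e))
        ≈⟨ sym (coefficient-concatMap (coloredDecSetoid l n) blockSum refinedBlocks (ρ , e)) ⟩
      coef (concatMap blockSum refinedBlocks) (ρ , e) ∎
      where
      perms : List (Permutation′ n)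
      perms = allPermutations n
      words : List (Vec (Fin (Block.blocks A)) n)
      words = allWords (Block.blocks A) n
      -- The value of `blocksOf`, which does not depend on α, restated where no α is in scope.
      blocksOf₀ : Permutation′ n → Vec (Fin (Block.blocks A)) n
      blocksOf₀ σ = rearranged ((ρ ∘ₚ Perm.flip σ) ⟨$⟩ʳ_) (tabulate (label A))

  -- Closure of the degree n component under the operations of the group algebra

  symₙ-≋ : ∀ {x y} → x ≋ₙ y → Symₙ R l n x → Symₙ R l n y
  symₙ-≋ {x} {y} x≋y = respects (inclusion-cong {x = x} {y} x≋y)

  symₙ-++ : ∀ {x y} → Symₙ R l n x → Symₙ R l n y → Symₙ R l n (x ++ y)
  symₙ-++ {x} {y} gx gy = ≡.subst (Sym R l) (≡.sym (List.concatMap-++ _ x y)) (addᵍ gx gy)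

  symₙ-scale : ∀ r {x} → Symₙ R l n x → Symₙ R l n (List.map (map₁ (r *_)) x)
  symₙ-scale r {x} gx = respects scaled (scaleᵍ r gx)
    where
    scaled : List.map (map₁ (r *_)) (inclusion R l n x) ≋ₛ inclusion R l n (List.map (map₁ (r *_)) x)
    scaled (m , h) with n ℕ.≟ m
    ... | yes ≡.refl = trans (coefficient-scale (allSizesDecSetoid l) r (inclusion R l n x) (n , h))
      (trans (*-congˡ (coefficient-inclusion x h))
        (trans (sym (coefficient-scale (coloredDecSetoid l n) r x h))
          (sym (coefficient-inclusion (List.map (map₁ (r *_)) x) h))))
    ... | no n≢m = trans (coefficient-scale (allSizesDecSetoid l) r (inclusion R l n x) (m , h))
      (trans (*-congˡ (coefficient-inclusion-≢ n≢m x h))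
        (trans (zeroʳ r) (sym (coefficient-inclusion-≢ n≢m (List.map (map₁ (r *_)) x) h))))

  symₙ-block : (A : Block n) → Symₙ R l n (blockSum A)
  symₙ-block A = block-sym (Block.blocks A) (label A) (Block.monotone A) (weight A)
    (λ {u} {v} → Block.symmetric A {u} {v})

  symₙ-blocks : (As : List (Block n)) → Symₙ R l n (concatMap blockSum As)
  symₙ-blocks []       = zeroᵍ
  symₙ-blocks (A ∷ As) = symₙ-++ {blockSum A} {concatMap blockSum As} (symₙ-block A) (symₙ-blocks As)

  symₙ-⊙ : ∀ {x y} → Symₙ R l n x → Symₙ R l n y → Symₙ R l n (x ⊙ y)
  symₙ-⊙ {x} {y} gx gy =
    let As , x≋ = symₙ⇒combination {x = x} gx
        Bs , y≋ = symₙ⇒combination {x = y} gy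
    in symₙ-≋ {concatMap blockSum As ⊙ concatMap blockSum Bs} {x ⊙ y}
      (⊙-cong {concatMap blockSum As} {x} {concatMap blockSum Bs} {y}
        (λ h → sym (x≋ h)) (λ h → sym (y≋ h)))
      (bilinear-closed (coloredDecSetoid l n) (λ g h → basis R (g · h)) {P = Symₙ R l n}
        (λ {x} {y} → symₙ-≋ {x} {y}) zeroᵍ (λ {x} {y} → symₙ-++ {x} {y}) blockSum
        (λ A B → symₙ-≋ {concatMap blockSum (refinedBlocks A B)} {blockSum A ⊙ blockSum B}
          (λ h → sym (⊙-refinedBlocks A B h)) (symₙ-blocks (refinedBlocks A B)))
        As Bs)

  private
    εs : Vec (Fin l) n
    εs = Vec.replicate n ε
    εContent : Vec ℕ l
    εContent = tabulate λ c → Vec.count (c Fin.≟_) εs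

  hasContent-εs : HasContent εContent εs
  hasContent-εs c = ≡.sym (Vec.lookup∘tabulate _ c)

  hasContent⇒εs : ∀ u → HasContent εContent u → u ≡ εs
  hasContent⇒εs u content =
    let π , _ , u≡ = sameContent⇒rearranged allZero {u} {εs}
          (sameContent-hasContent {𝐧 = εContent} {u} {εs} content hasContent-εs)
    in ≡.trans u≡ (≡.trans
      (Vec.tabulate-cong λ x → ≡.trans (Vec.lookup-replicate (π ⟨$⟩ʳ x) ε) (≡.sym (Vec.lookup-replicate x ε)))
      (Vec.tabulate∘lookup εs))

  -- The unit is the identity permutation with all colors ε. The constant word is the only word of
  -- its content, so the unit is the generator `S εContent`.
  symₙ-one : Symₙ R l n (basis R (≀ε C n))
  symₙ-one = symₙ-≋ {blockSum (contentBlock εContent)} {basis R (≀ε C n)}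
    (λ (ρ , e) → trans (coefficient-blockSum (contentBlock εContent) (ρ , e))
      (trans (sym (indicator-× (increasingOnBlocks? allZero (ρ ⟨$⟩ʳ_)) (hasContent? εContent e)))
        (trans (indicator-⇔
          (mk⇔ (λ (inc , content) → Equivalence.from (id≈⇔increasing ρ) inc , ≡.sym (hasContent⇒εs e content))
               (λ (id≈ρ , εs≡e) → Equivalence.to (id≈⇔increasing ρ) id≈ρ ,
                  ≡.subst (HasContent εContent) εs≡e hasContent-εs))
          (increasingOnBlocks? allZero (ρ ⟨$⟩ʳ_) ×-dec hasContent? εContent e)
          (≀ε C n CP.≟ (ρ , e)))
        (sym (+-identityʳ _)))))
    (symₙ-block (contentBlock εContent))

  -- Both sides are formal sums over the same basis, so the identification does not change
  -- coefficients and its image is `Symₙ` itself.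
  identification-≋ : ∀ x → identification R C n x ≋ₙ x
  identification-≋ x h = trans (coefficient-linearExtension (coloredDecSetoid l n) (basis R) x h)
    (trans (∑-cong x λ (r , g) → *-congˡ (+-identityʳ _))
      (sym (coefficient-evaluate (coloredDecSetoid l n) x h)))

  image⇒symₙ : ∀ y → Image (wreathAlgebra R C n) (identification R C n) (Symₙ R l n) y → Symₙ R l n y
  image⇒symₙ y (x , gx , x≋y) =
    symₙ-≋ {x} {y} (λ h → trans (sym (identification-≋ x h)) (x≋y h)) gx

  symₙ⇒image : ∀ y → Symₙ R l n y → Image (wreathAlgebra R C n) (identification R C n) (Symₙ R l n) y
  symₙ⇒image y gy = y , gy , identification-≋ y

  image-isSubalgebra : IsSubalgebra (wreathAlgebra R C n)
    (Image (wreathAlgebra R C n) (identification R C n) (Symₙ R l n))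
  image-isSubalgebra = record
    { ≈-closed  = λ {x} {y} x≋y (z , gz , z≋x) → z , gz , λ h → trans (z≋x h) (x≋y h)
    ; 0#-closed = symₙ⇒image [] zeroᵍ
    ; +-closed  = λ {x} {y} ix iy → symₙ⇒image (x ++ y) (symₙ-++ {x} {y} (image⇒symₙ x ix) (image⇒symₙ y iy))
    ; *ₗ-closed = λ r {x} ix → symₙ⇒image (List.map (map₁ (r *_)) x) (symₙ-scale r {x} (image⇒symₙ x ix))
    ; 1#-closed = symₙ⇒image (basis R (≀ε C n)) symₙ-one
    ; *-closed  = λ {x} {y} ix iy → symₙ⇒image (x ⊙ y) (symₙ-⊙ {x} {y} (image⇒symₙ x ix) (image⇒symₙ y iy))
    }

theorem3p2 : ∀ {c ℓ} (R : CommutativeRing c ℓ) (l : ℕ) → 1 ≤ l →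
    ∀ {_∙_ : Op₂ (Fin l)} {ε : Fin l} {_⁻¹ : Op₁ (Fin l)}
    (C : IsGroup _≡_ _∙_ ε _⁻¹) (n : ℕ) →
    IsSubalgebra (wreathAlgebra R C n)
    (Image (wreathAlgebra R C n) (identification R C n) (Symₙ R l n))
theorem3p2 R l _ C n = Wreath.image-isSubalgebra R C n
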